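{- (1) Let $\lambda,\mu,\varkappa$ be partitions with $\varkappa\prec\lambda$ and $\varkappa\prec\mu$, and let $k\in\mathbb Z_{\ge0}$. The procedure of dragging the cross rightward across the two rows $\lambda/\varkappa$ and $\mu/\varkappa$ (described in the context), which takes $(\lambda,\mu,\varkappa,k)$ and rewrites $\varkappa$ into a new sequence $\nu=(\nu_1,\nu_2,\dots)$ one column at a time by the deterministic weight-preserving matching of the two sides of the Yang--Baxter equation, is well defined and reproduces the local (toggle) rule \[ \nu_1=k+\max(\lambda_1,\mu_1),\qquad \nu_{c+1}=\max(\lambda_{c+1},\mu_{c+1})+\min(\lambda_c,\mu_c)-\varkappa_c\quad(c\ge1). \] (2) Consequently, performing these moves over the $N\times N$ grid produces the Robinson--Schensted--Knuth correspondence. That is, let $(k_{ab})_{1\le a,b\le N}$ be a matrix of nonnegative integers. Set $\Lambda(a,0)=\Lambda(0,b)=\varnothing$ for $0\le a,b\le N$, and for $1\le a,b\le N$ let $\Lambda(a,b)=\nu$ be the output of the procedure in (1) with $\varkappa=\Lambda(a-1,b-1)$, $\lambda=\Lambda(a-1,b)$, $\mu=\Lambda(a,b-1)$, $k=k_{ab}$. Then the tableau in which the boxes of $\Lambda(a,N)/\Lambda(a-1,N)$ are filled with $a$ ($1\le a\le N$) and the tableau in which the boxes of $\Lambda(N,b)/\Lambda(N,b-1)$ are filled with $b$ ($1\le b\le N$) are, respectively, the insertion tableau $P$ and the recording tableau $Q$ of the classical (row insertion) RSK correspondence applied to $(k_{ab})$.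
   Context: Partitions are weakly decreasing sequences of nonnegative integers $\lambda=(\lambda_1\ge\lambda_2\ge\cdots)$ with finitely many nonzero terms. $\mu\prec\lambda$ means $\lambda_1\ge\mu_1\ge\lambda_2\ge\mu_2\ge\cdots$ (i.e. $\lambda/\mu$ is a horizontal strip). Vertex weights (arguments in $\mathbb Z_{\ge0}$; $x,y$ independent indeterminates; $\mathbf 1$ is the indicator): $W_x(i_1,j_1;i_2,j_2)=\mathbf 1_{i_1+j_1=i_2+j_2}\mathbf 1_{i_1\ge j_2}x^{j_2}$, $W^*_y(i_1,j_1;i_2,j_2)=\mathbf 1_{i_2+j_1=i_1+j_2}\mathbf 1_{i_2\ge j_2}y^{j_2}$, and the cross $\mathbb R_{x,y}(i_1,j_1;i_2,j_2)=\mathbf 1_{i_1+j_2=j_1+i_2}(xy)^{\min(i_2,j_2)}$. For boundary data $i_1,i_2,i_3,j_1,j_2,j_3\in\mathbb Z_{\ge0}$ with $i_1+j_2+j_3=i_2+i_3+j_1$, they satisfy the Yang--Baxter equation \[ \sum_{k_1,k_2,k_3\ge0}\mathbb R_{x,y}(i_2,i_1;k_2,k_1)W_x(k_3,k_2;j_3,j_2)W^*_y(i_3,k_1;k_3,j_1)=\sum_{k_1',k_2',k_3'\ge0}W_x(i_3,i_2;k_3',k_2')W^*_y(k_3',i_1;j_3,k_1')\mathbb R_{x,y}(k_2',k_1';j_2,j_1). \] On the left $k_2=i_2+k_1-i_1$, $k_3=i_3+j_1-k_1$, and on the right $k_2'=k_1'+j_2-j_1$, $k_3'=j_3+i_1-k_1'$.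 Nonzero summands occur exactly for $\max(0,i_1-i_2)\le k_1\le\min(i_3,i_3+j_1-j_2)$ on the left and $\max(0,j_1-j_2)\le k_1'\le\min(j_3,j_3+i_1-i_2)$ on the right. The deterministic move sends the left state $k_1$ to the right state $k_1'$ by the unique weight-preserving bijection between these nonzero summands, $k_1'=j_1-\min(j_1,j_2)+\min(k_1,k_2)$; equivalently $k_3'=k_3+\max(i_1,i_2)-\max(j_1,j_2)$. Dragging procedure for $(\lambda,\mu,\varkappa,k)$. Column $0$ (carrying infinitely many vertical arrows, so that a vertex of parameter $z$ there has weight $z^{j_2}$, where $j_2$ is the number of arrows leaving it to the right, with no constraint relating vertical and horizontal occupations): with arbitrary incoming occupations $i_1,i_2\ge0$ to the cross, the cross has outgoing occupations $k_2$ on its $x$-line and $k_1$ on its $y$-line with $\min(k_1,k_2)=k$. The occupations on the far right are $j_2=\mu_1-\varkappa_1$ (on the $x$-line) and $j_1=\lambda_1-\varkappa_1$ (on the $y$-line). The left state has weight $(xy)^kx^{j_2}y^{j_1}$; it is matched with the right state, determined by $k_1',k_2'\ge0$ with $k_2'+j_1=k_1'+j_2$, of equal weight $x^{k_2'}y^{k_1'}(xy)^{\min(j_1,j_2)}$. Then $\nu_1$ is defined by $k_1'=\nu_1-\mu_1$, equivalently $k_2'=\nu_1-\lambda_1$. Column $c\ge1$: once $\nu_c$ is known, apply the deterministic move with boundary data \[ i_1=\nu_c-\mu_c,\quad i_2=\nu_c-\lambda_c,\quad i_3=\lambda_c-\lambda_{c+1},\quad j_3=\mu_c-\mu_{c+1},\quad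 j_1=\lambda_{c+1}-\varkappa_{c+1},\quad j_2=\mu_{c+1}-\varkappa_{c+1} \] to the left state with $k_3=\varkappa_c-\varkappa_{c+1}$, and define $\nu_{c+1}$ by $k_3'=\nu_c-\nu_{c+1}$. Classical RSK for $(k_{ab})$: form the biword containing each pair $\binom{b}{a}$ exactly $k_{ab}$ times, the pairs ordered by increasing $b$ and, for equal $b$, by weakly increasing $a$. Reading left to right, row insert each lower letter $a$ into $P$ (Schensted row insertion: $a$ replaces the leftmost entry strictly greater than $a$ in the row, or is appended at the end of the row if there is none; the replaced entry is inserted into the next row), and record the corresponding upper letter $b$ in $Q$ in the box newly added to the shape. -}

module Defs where

open import Data.Fin using (Fin; zero; suc; inject₁; _<?_)
open import Data.List using (List; []; _∷_; length; replicate; concatMap; allFin; foldl)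
open import Data.Maybe using (Maybe; just; nothing; Is-just; zipWith)
open import Data.Nat using (ℕ; zero; suc; _+_; _≤_; _<_; _⊓_; _≟_; _≥?_)
open import Data.Product using (Σ; ∃; _×_; _,_; proj₁)
open import Data.Product.Properties using (≡-dec)
open import Function using (_⇔_; Bijective)
open import Relation.Binary.PropositionalEquality using (_≡_; _≗_)
open import Relation.Nullary using (Dec; yes; no)

-- Indices start at 0: part lam c is λ_{c+1}.
record Partition : Set where
  field
    part       : ℕ → ℕ
    decreasing : ∀ c → part (suc c) ≤ part c
    finite     : ∃ λ n → ∀ c → n ≤ c → part c ≡ 0

open Partition public

_≈_ : Partition → Partition → Set
lam ≈ μ = part lam ≗ part μ

_≺_ : Partition → Partition → Set
μ ≺ lam = ∀ c → part μ c ≤ part lam c × part lam (suc c) ≤ part μ c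

-- Every weight is 0 or a monomial x^m y^n with coefficient 1 in the independent
-- indeterminates x, y; these are nothing and just (m , n).
Weight : Set
Weight = Maybe (ℕ × ℕ)

Nonzero : Weight → Set
Nonzero = Is-just

infixl 7 _⊗_
_⊗_ : Weight → Weight → Weight
_⊗_ = zipWith λ (m , n) (m′ , n′) → m + m′ , n + n′

x^ y^ xy^ : ℕ → Weight
x^ n  = just (n , 0)
y^ n  = just (0 , n)
xy^ n = just (n , n)

𝟏[_] : {P : Set} → Dec P → Weight
𝟏[ yes _ ] = just (0 , 0)
𝟏[ no _ ]  = nothing

Wx Wy* R : (i₁ j₁ i₂ j₂ : ℕ) → Weight
Wx  i₁ j₁ i₂ j₂ = 𝟏[ i₁ + j₁ ≟ i₂ + j₂ ] ⊗ 𝟏[ i₁ ≥? j₂ ] ⊗ x^ j₂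
Wy* i₁ j₁ i₂ j₂ = 𝟏[ i₂ + j₁ ≟ i₁ + j₂ ] ⊗ 𝟏[ i₂ ≥? j₂ ] ⊗ y^ j₂
R   i₁ j₁ i₂ j₂ = 𝟏[ i₁ + j₂ ≟ j₁ + i₂ ] ⊗ xy^ (i₂ ⊓ j₂)

record Boundary : Set where
  field
    i₁ i₂ i₃ j₁ j₂ j₃ : ℕ
    conserved : i₁ + j₂ + j₃ ≡ i₂ + i₃ + j₁

record Internal : Set where
  constructor internal
  field
    k₁ k₂ k₃ : ℕ

module YangBaxter (B : Boundary) where
  open Boundary B

  leftWeight rightWeight : Internal → Weight
  leftWeight  (internal k₁ k₂ k₃) = R i₂ i₁ k₂ k₁ ⊗ Wx k₃ k₂ j₃ j₂ ⊗ Wy* i₃ k₁ k₃ j₁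
  rightWeight (internal k₁ k₂ k₃) = Wx i₃ i₂ k₃ k₂ ⊗ Wy* k₃ i₁ j₃ k₁ ⊗ R k₂ k₁ j₂ j₁

  -- The nonzero summands of the two sides of the Yang–Baxter equation.
  LeftState RightState : Set
  LeftState  = Σ Internal λ s → Nonzero (leftWeight s)
  RightState = Σ Internal λ t → Nonzero (rightWeight t)

  -- There is at most one such φ up to ≗, since distinct right states have
  -- distinct weights; it is k₁′ = j₁ − min(j₁,j₂) + min(k₁,k₂).
  record IsMove (φ : LeftState → RightState) : Set where
    field
      bijective         : Bijective _≡_ _≡_ φ
      weight-preserving : ∀ s → rightWeight (proj₁ (φ s)) ≡ leftWeight (proj₁ s)

-- Here and below, a definition a = b − c of a ∈ ℤ≥0 is written a + c ≡ b,
-- which includes the requirement c ≤ b.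
module Dragging (i₁ i₂ : ℕ) (lam μ ϰ : Partition) (k : ℕ) where

  -- A vertex of the infinitely occupied column has weight x^ j or y^ j, with j
  -- the number of arrows leaving to the right, and imposes no constraint.
  record Column₀ (ν₁ : ℕ) : Set where
    field
      k₁ k₂ k₁′ k₂′ j₁ j₂ : ℕ
      min-k   : k₁ ⊓ k₂ ≡ k
      j₁-def  : j₁ + part ϰ 0 ≡ part lam 0
      j₂-def  : j₂ + part ϰ 0 ≡ part μ 0
      nonzero : Nonzero (R i₂ i₁ k₂ k₁ ⊗ x^ j₂ ⊗ y^ j₁)
      matched : x^ k₂′ ⊗ y^ k₁′ ⊗ R k₂′ k₁′ j₂ j₁ ≡ R i₂ i₁ k₂ k₁ ⊗ x^ j₂ ⊗ y^ j₁
      ν₁-def  : k₁′ + part μ 0 ≡ ν₁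

  record Column (c ν-c ν-1+c : ℕ) : Set where
    field
      B : Boundary
    open Boundary B renaming (i₁ to I₁; i₂ to I₂) public
    open YangBaxter B public
    field
      i₁-def  : I₁ + part μ c ≡ ν-c
      i₂-def  : I₂ + part lam c ≡ ν-c
      i₃-def  : i₃ + part lam (suc c) ≡ part lam c
      j₃-def  : j₃ + part μ (suc c) ≡ part μ c
      j₁-def  : j₁ + part ϰ (suc c) ≡ part lam (suc c)
      j₂-def  : j₂ + part ϰ (suc c) ≡ part μ (suc c)
      φ       : LeftState → RightState
      isMove  : IsMove φ
      s       : LeftState
      k₃-def  : Internal.k₃ (proj₁ s) + part ϰ (suc c) ≡ part ϰ c
      k₃′-def : Internal.k₃ (proj₁ (φ s)) + ν-1+c ≡ ν-c

  -- Computed c v: a run of the procedure reaches v as the part of ν with index c.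
  data Computed : ℕ → ℕ → Set where
    start : ∀ {ν₁} → Column₀ ν₁ → Computed 0 ν₁
    next  : ∀ {c ν-c ν-1+c} → Computed c ν-c → Column c ν-c ν-1+c → Computed (suc c) ν-1+c

  Output : (ℕ → ℕ) → Set
  Output ν = ∀ c → Computed c (ν c)

open Dragging public using (Computed; Output)

Matrix : ℕ → Set
Matrix N = Fin N → Fin N → ℕ

-- i₁ a b and i₂ a b are the arbitrary occupations entering the cross of cell (a , b).
record IsGrid {N : ℕ} (i₁ i₂ k : Matrix N) (Λ : Fin (suc N) → Fin (suc N) → Partition) : Set where
  field
    emptyˡ : ∀ b c → part (Λ zero b) c ≡ 0
    emptyʳ : ∀ a c → part (Λ a zero) c ≡ 0
    ϰ≺lam  : ∀ a b → Λ (inject₁ a) (inject₁ b) ≺ Λ (inject₁ a) (suc b)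
    ϰ≺μ    : ∀ a b → Λ (inject₁ a) (inject₁ b) ≺ Λ (suc a) (inject₁ b)
    cell   : ∀ a b → Output (i₁ a b) (i₂ a b)
                       (Λ (inject₁ a) (suc b)) (Λ (suc a) (inject₁ b)) (Λ (inject₁ a) (inject₁ b))
                       (k a b) (part (Λ (suc a) (suc b)))

-- (row , column), both starting at 0.
Box : Set
Box = ℕ × ℕ

_∈_/_ : Box → Partition → Partition → Set
(r , c) ∈ lam / μ = part μ r ≤ c × c < part lam r

Filling : ℕ → Set
Filling N = Box → Maybe (Fin N)

FilledBy : ∀ {N} → (Fin (suc N) → Partition) → Filling N → Set
FilledBy Λ T = ∀ box a → T box ≡ just a ⇔ box ∈ Λ (suc a) / Λ (inject₁ a)

module _ {N : ℕ} where

  Row : Set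
  Row = List (Fin N)

  -- Pairs (b , a): upper letter, then lower letter.
  biword : Matrix N → List (Fin N × Fin N)
  biword k = concatMap (λ b → concatMap (λ a → replicate (k a b) (b , a)) (allFin N)) (allFin N)

  -- The new row and the replaced entry, if there is one.
  rowInsert : Fin N → Row → Row × Maybe (Fin N)
  rowInsert a [] = a ∷ [] , nothing
  rowInsert a (e ∷ row) with a <? e
  ... | yes _ = a ∷ row , just e
  ... | no  _ = let row′ , bumped = rowInsert a row in e ∷ row′ , bumped

  -- The new tableau and the box added to its shape.
  insert : Fin N → List Row → List Row × Box
  insert a [] = (a ∷ []) ∷ [] , (0 , 0)
  insert a (row ∷ rows) with rowInsert a row
  ... | row′ , nothing = row′ ∷ rows , (0 , length row)
  ... | row′ , just e  = let rows′ , (r , c) = insert e rows in row′ ∷ rows′ , (suc r , c)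

  record-in : Box → Fin N → Filling N → Filling N
  record-in new b Q box with ≡-dec _≟_ _≟_ box new
  ... | yes _ = just b
  ... | no  _ = Q box

  rsk : Matrix N → List Row × Filling N
  rsk k = foldl step ([] , λ _ → nothing) (biword k)
    where
    step : List Row × Filling N → Fin N × Fin N → List Row × Filling N
    step (P , Q) (b , a) = let P′ , new = insert a P in P′ , record-in new b Q

  rowEntry : Row → ℕ → Maybe (Fin N)
  rowEntry []        _       = nothing
  rowEntry (e ∷ row) zero    = just e
  rowEntry (e ∷ row) (suc c) = rowEntry row c

  filling : List Row → Filling N
  filling []           _           = nothing
  filling (row ∷ rows) (zero , c)  = rowEntry row c
  filling (row ∷ rows) (suc r , c) = filling rows (r , c)

  insertionTableau recordingTableau : Matrix N → Filling N
  insertionTableau k = let P , Q = rsk k in filling P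
  recordingTableau k = let P , Q = rsk k in Q

{-# OPTIONS --safe #-}

-- (1) The nonzero states on either side of the Yang–Baxter equation form an interval on which
-- min(k₁,k₂) is a coordinate, and the two sides are exchanged by swapping the data i and j. A
-- weight-preserving map must keep min(k₁,k₂), so the move is determined, and k₁′ comes out as the
-- toggle rule.
-- (2) Insert a weakly increasing word w into a row, and let ρ(n), ρ′(n) count the entries at most n
-- before and after. Letters smaller than n bump the entries n at positions up to ρ′(n−1), and then
-- the letters n are placed, so ρ′(n) = #ₙ(w) + max(ρ′(n−1), ρ(n)), and
-- min(ρ′(n−1), ρ(n)) − ρ(n−1) copies of n are bumped into the next row. This is the toggle rule for
-- the shapes of the entries at most a after the pairs with upper letter at most b, so these shapes
-- are Λ(a,b).
module Submission where

open import Defs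
open import Data.Fin using (Fin; zero; suc; toℕ; fromℕ; inject₁)
import Data.Fin as Fin
open import Data.Fin.Induction using (<-weakInduction)
import Data.Fin.Properties as Finₚ
open import Data.List using (List; []; _∷_; _++_; length; filter; drop; foldl; concatMap; replicate; allFin; tabulate; map; fromMaybe)
open import Data.List.Properties using (filter-none; filter-all; filter-accept; filter-reject; filter-++; length-++; length-replicate; map-replicate; foldl-++; foldl-cong; map-concatMap; concatMap-cong)
open import Data.List.Relation.Unary.All as All using (All; []; _∷_)
import Data.List.Relation.Unary.All.Properties as Allₚ
open import Data.List.Relation.Unary.AllPairs using (AllPairs; []; _∷_)
import Data.List.Relation.Unary.AllPairs.Properties as AllPairsₚ
open import Data.Maybe using (just; nothing; maybe)
open import Data.Maybe.Properties using (just-injective)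
import Data.Maybe.Relation.Unary.Any as Any
open import Data.Nat using (ℕ; zero; suc; _+_; _∸_; _⊔_; _⊓_; _≤_; _<_; _≮_; _≟_; _≥?_; _≤?_; _<?_; z≤n; s≤s; s≤s⁻¹)
open import Data.Nat.Properties
open import Data.Nat.Tactic.RingSolver using (solve-∀)
open import Data.Product using (_×_; ∃!; Σ; ∃; ∃₂; _,_; proj₁; proj₂)
open import Data.Product.Properties using (≡-dec)
open import Data.Sum using (_⊎_; inj₁; inj₂)
open import Data.Unit using (tt)
open import Function using (_∘_; id; Injective; _⇔_; mk⇔; Equivalence)
open import Function.Consequences.Propositional using (strictlyInverseˡ⇒inverseˡ; strictlyInverseʳ⇒inverseʳ; inverseᵇ⇒bijective)
open import Relation.Binary.Definitions using (tri<; tri≈; tri>)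
open import Relation.Binary.PropositionalEquality
open import Relation.Nullary using (¬_; Dec; yes; no; contradiction)

-- The two halves meet in `Toggle`, a rule for bare sequences written without subtraction. The
-- procedure obeys it because of the exponents of the weights, the shapes of RSK because of
-- counting, and a family with empty borders that obeys it is unique. That the sequences produced in
-- the grid are partitions is read off from the RSK shapes, by interlacing.
--
-- The word bumped out of a row is again weakly increasing and is the input word of the row below.
-- Its letter counts therefore play for that row the part that `k` plays for the first one, and
-- eliminating them between two neighbouring rows leaves the rule for `c ≥ 1`.
--
-- The obstacle is the order of operations: insertion chases each bumped letter down the tableau
-- before it takes the next letter, while the counting needs a whole word sent through one row.
-- `Inserted` is such a passage in a single sweep, possible because no letter of a weakly increasing
-- word lands to the left of its predecessor.

-- Turns a goal that follows from l ≡ r by cancellation into a semiring identity.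
cancel : ∀ {a b l r} → l ≡ r → a + r ≡ b + l → a ≡ b
cancel {a} {b} {l} refl = +-cancelʳ-≡ l a b

infixl 6 _⊕_
_⊕_ : ∀ {a b c d : ℕ} → a ≡ b → c ≡ d → a + c ≡ b + d
_⊕_ = cong₂ _+_

-- Minimum, maximum and truncated subtraction

∸-⊔ : ∀ m n → (m ∸ n) + n ≡ m ⊔ n
∸-⊔ zero    zero    = refl
∸-⊔ zero    (suc n) = refl
∸-⊔ (suc m) zero    = +-identityʳ (suc m)
∸-⊔ (suc m) (suc n) = trans (+-suc (m ∸ n) n) (cong suc (∸-⊔ m n))

⊓-∸∸ : ∀ m n → (m ∸ n) ⊓ (n ∸ m) ≡ 0
⊓-∸∸ zero    zero    = refl
⊓-∸∸ zero    (suc n) = refl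
⊓-∸∸ (suc m) zero    = refl
⊓-∸∸ (suc m) (suc n) = ⊓-∸∸ m n

⊓+⊔ : ∀ m n → m ⊓ n + (m ⊔ n) ≡ m + n
⊓+⊔ m n = begin
  m ⊓ n + (m ⊔ n)        ≡⟨ cong (m ⊓ n +_) (∸-⊔ m n) ⟨
  m ⊓ n + (m ∸ n + n)    ≡⟨ +-assoc (m ⊓ n) (m ∸ n) n ⟨
  m ⊓ n + (m ∸ n) + n    ≡⟨ cong (λ x → x + (m ∸ n) + n) (⊓-comm m n) ⟩
  n ⊓ m + (m ∸ n) + n    ≡⟨ cong (_+ n) (m⊓n+n∸m≡n n m) ⟩
  m + n                  ∎
  where open ≡-Reasoning

-- Where arrows are conserved, the indicator of a vertex can be read on either of two pairs of
-- edges. This turns the bounds `k₂ ≤ i₃` and `k₁ ≤ j₃` of the right vertices into the bounds on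
-- `k₃` that `Balanced (swap B)` asks for.
complementary-≤ : ∀ {a b c d} → a + b ≡ c + d → d ≤ a → b ≤ c
complementary-≤ {a} {b} {c} {d} eq d≤a = +-cancelʳ-≤ a b c (begin
  b + a   ≡⟨ +-comm b a ⟩
  a + b   ≡⟨ eq ⟩
  c + d   ≤⟨ +-monoʳ-≤ c d≤a ⟩
  c + a   ∎)
  where open ≤-Reasoning

-- The maximum of the toggle rule enters here: equality of the exponents of y only speaks of the
-- minimum of `j₁` and `j₂`, and minimum plus maximum is their sum.
complementary-⊓⊔ : ∀ {k m} j₁ j₂ → k + j₁ ⊓ j₂ ≡ m + j₁ → k + j₂ ≡ m + (j₁ ⊔ j₂)
complementary-⊓⊔ {k} {m} j₁ j₂ eq =
  cancel (eq ⊕ sym (⊓+⊔ j₁ j₂)) (lemma k m j₁ j₂ (j₁ ⊓ j₂) (j₁ ⊔ j₂))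
  where
  lemma : ∀ k m j₁ j₂ p q → k + j₂ + (m + j₁ + (p + q)) ≡ m + q + (k + p + (j₁ + j₂))
  lemma = solve-∀

-- The numbers `m + (i ∸ j)` and `m + (j ∸ i)` are the pair with minimum `m` and difference i - j.
-- The `shift` lemmas compute with this pair without asking which of `i` and `j` is larger.
shift-⊓ : ∀ m i j → m + (i ∸ j) + i ⊓ j ≡ m + i
shift-⊓ m i j = begin
  m + (i ∸ j) + i ⊓ j     ≡⟨ +-assoc m (i ∸ j) (i ⊓ j) ⟩
  m + ((i ∸ j) + i ⊓ j)   ≡⟨ cong (m +_) (+-comm (i ∸ j) (i ⊓ j)) ⟩
  m + (i ⊓ j + (i ∸ j))   ≡⟨ cong (λ x → m + (x + (i ∸ j))) (⊓-comm i j) ⟩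
  m + (j ⊓ i + (i ∸ j))   ≡⟨ cong (m +_) (m⊓n+n∸m≡n j i) ⟩
  m + i                   ∎
  where open ≡-Reasoning

shift-⊔ : ∀ m i j → m + (i ∸ j) + j ≡ m + (i ⊔ j)
shift-⊔ m i j = trans (+-assoc m (i ∸ j) j) (cong (m +_) (∸-⊔ i j))

shift-balanced : ∀ m i j → j + (m + (i ∸ j)) ≡ i + (m + (j ∸ i))
shift-balanced m i j = begin
  j + (m + (i ∸ j))   ≡⟨ +-comm j _ ⟩
  m + (i ∸ j) + j     ≡⟨ shift-⊔ m i j ⟩
  m + (i ⊔ j)         ≡⟨ cong (m +_) (⊔-comm i j) ⟩
  m + (j ⊔ i)         ≡⟨ shift-⊔ m j i ⟨
  m + (j ∸ i) + i     ≡⟨ +-comm _ i ⟩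
  i + (m + (j ∸ i))   ∎
  where open ≡-Reasoning

shift-min : ∀ m i j → (m + (i ∸ j)) ⊓ (m + (j ∸ i)) ≡ m
shift-min m i j = begin
  (m + (i ∸ j)) ⊓ (m + (j ∸ i))   ≡⟨ +-distribˡ-⊓ m (i ∸ j) (j ∸ i) ⟨
  m + (i ∸ j) ⊓ (j ∸ i)           ≡⟨ cong (m +_) (⊓-∸∸ i j) ⟩
  m + 0                           ≡⟨ +-identityʳ m ⟩
  m                               ∎
  where open ≡-Reasoning

-- Values of the vertex weights

𝟏-nonzero : ∀ {P : Set} (d : Dec P) → Nonzero 𝟏[ d ] → P
𝟏-nonzero (yes p) _ = p

𝟏-true : ∀ {P : Set} (d : Dec P) → P → 𝟏[ d ] ≡ just (0 , 0)
𝟏-true (yes _) _ = refl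
𝟏-true (no ¬p) p = contradiction p ¬p

⊗-nonzero : ∀ u v → Nonzero (u ⊗ v) → Nonzero u × Nonzero v
⊗-nonzero (just _) (just _) _ = Any.just tt , Any.just tt

nonzero-≡ : ∀ {w : Weight} {mn} → w ≡ just mn → Nonzero w
nonzero-≡ refl = Any.just tt

R-nonzero : ∀ i₁ j₁ i₂ j₂ → Nonzero (R i₁ j₁ i₂ j₂) → i₁ + j₂ ≡ j₁ + i₂
R-nonzero i₁ j₁ i₂ j₂ nz = 𝟏-nonzero _ (proj₁ (⊗-nonzero 𝟏[ i₁ + j₂ ≟ j₁ + i₂ ] _ nz))

R-value : ∀ i₁ j₁ i₂ j₂ → i₁ + j₂ ≡ j₁ + i₂ → R i₁ j₁ i₂ j₂ ≡ xy^ (i₂ ⊓ j₂)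
R-value i₁ j₁ i₂ j₂ eq rewrite 𝟏-true (i₁ + j₂ ≟ j₁ + i₂) eq = refl

Wx-nonzero : ∀ i₁ j₁ i₂ j₂ → Nonzero (Wx i₁ j₁ i₂ j₂) → i₁ + j₁ ≡ i₂ + j₂ × j₂ ≤ i₁
Wx-nonzero i₁ j₁ i₂ j₂ nz =
  let nz₁ , _ = ⊗-nonzero (𝟏[ i₁ + j₁ ≟ i₂ + j₂ ] ⊗ 𝟏[ i₁ ≥? j₂ ]) _ nz
      nz₂ , nz₃ = ⊗-nonzero 𝟏[ i₁ + j₁ ≟ i₂ + j₂ ] _ nz₁
  in 𝟏-nonzero _ nz₂ , 𝟏-nonzero (i₁ ≥? j₂) nz₃

Wx-value : ∀ i₁ j₁ i₂ j₂ → i₁ + j₁ ≡ i₂ + j₂ → j₂ ≤ i₁ → Wx i₁ j₁ i₂ j₂ ≡ x^ j₂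
Wx-value i₁ j₁ i₂ j₂ eq le
  rewrite 𝟏-true (i₁ + j₁ ≟ i₂ + j₂) eq | 𝟏-true (i₁ ≥? j₂) le = refl

Wy*-nonzero : ∀ i₁ j₁ i₂ j₂ → Nonzero (Wy* i₁ j₁ i₂ j₂) → i₂ + j₁ ≡ i₁ + j₂ × j₂ ≤ i₂
Wy*-nonzero i₁ j₁ i₂ j₂ nz =
  let nz₁ , _ = ⊗-nonzero (𝟏[ i₂ + j₁ ≟ i₁ + j₂ ] ⊗ 𝟏[ i₂ ≥? j₂ ]) _ nz
      nz₂ , nz₃ = ⊗-nonzero 𝟏[ i₂ + j₁ ≟ i₁ + j₂ ] _ nz₁
  in 𝟏-nonzero _ nz₂ , 𝟏-nonzero (i₂ ≥? j₂) nz₃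

Wy*-value : ∀ i₁ j₁ i₂ j₂ → i₂ + j₁ ≡ i₁ + j₂ → j₂ ≤ i₂ → Wy* i₁ j₁ i₂ j₂ ≡ y^ j₂
Wy*-value i₁ j₁ i₂ j₂ eq le
  rewrite 𝟏-true (i₂ + j₁ ≟ i₁ + j₂) eq | 𝟏-true (i₂ ≥? j₂) le = refl

-- The deterministic move

swap : Boundary → Boundary
swap B = record
  { i₁ = j₁ ; i₂ = j₂ ; i₃ = j₃ ; j₁ = i₁ ; j₂ = i₂ ; j₃ = i₃
  ; conserved = trans (rearrange j₁ i₂ i₃) (trans (sym conserved) (sym (rearrange′ j₂ j₃ i₁))) }
  where
  open Boundary B
  rearrange : ∀ a b c → a + b + c ≡ b + c + a
  rearrange = solve-∀
  rearrange′ : ∀ a b c → a + b + c ≡ c + a + b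
  rearrange′ = solve-∀

crossMin : Internal → ℕ
crossMin (internal k₁ k₂ _) = k₁ ⊓ k₂

-- The nonzero left states of B; exchanging i and j gives its nonzero right states.
record Balanced (B : Boundary) (s : Internal) : Set where
  open Boundary B
  open Internal s
  field
    cross : i₂ + k₁ ≡ i₁ + k₂
    x-line : k₃ + k₂ ≡ j₃ + j₂
    x-bound : j₂ ≤ k₃
    y-line : k₃ + k₁ ≡ i₃ + j₁
    y-bound : j₁ ≤ k₃

-- The cross fixes the difference of its two occupations, so they grow together and their minimum is
-- strictly monotone in either.
⊓-determines : ∀ {i₁ i₂ k₁ k₂ l₁ l₂} → i₂ + k₁ ≡ i₁ + k₂ → i₂ + l₁ ≡ i₁ + l₂ →
               k₁ ⊓ k₂ ≡ l₁ ⊓ l₂ → k₁ ≡ l₁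
⊓-determines {i₁} {i₂} {k₁} {k₂} {l₁} {l₂} p q eq with <-cmp k₁ l₁
... | tri≈ _ k≡l _ = k≡l
... | tri< k<l _ _ = contradiction eq (<⇒≢ (⊓-mono-< k<l
        (+-cancelˡ-< i₁ k₂ l₂ (subst₂ _<_ p q (+-monoʳ-< i₂ k<l)))))
... | tri> _ _ l<k = contradiction (sym eq) (<⇒≢ (⊓-mono-< l<k
        (+-cancelˡ-< i₁ l₂ k₂ (subst₂ _<_ q p (+-monoʳ-< i₂ l<k)))))

balanced-unique : ∀ B {s t} → Balanced B s → Balanced B t → crossMin s ≡ crossMin t → s ≡ t
balanced-unique B {internal k₁ k₂ k₃} {internal l₁ l₂ l₃} b b′ eq
  with ⊓-determines (Balanced.cross b) (Balanced.cross b′) eq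
... | refl with +-cancelˡ-≡ (Boundary.i₁ B) k₂ l₂ (trans (sym (Balanced.cross b)) (Balanced.cross b′))
              | +-cancelʳ-≡ k₁ k₃ l₃ (trans (Balanced.y-line b) (sym (Balanced.y-line b′)))
... | refl | refl = refl

-- The cross occupations are the pair with the old minimum and the difference j₁ - j₂ that the right
-- cross demands; the third occupation is what conservation on the x-line leaves. On balanced states
-- the last subtraction does not truncate.
move : Boundary → Internal → Internal
move B s = internal (m + (j₁ ∸ j₂)) (m + (j₂ ∸ j₁)) ((i₃ + i₂) ∸ (m + (j₂ ∸ j₁)))
  where
  open Boundary B
  m = crossMin s

crossMin-move : ∀ B s → crossMin (move B s) ≡ crossMin s
crossMin-move B s = shift-min (crossMin s) (Boundary.j₁ B) (Boundary.j₂ B)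

-- Both new bounds come from one estimate: `m` is at most `k₁` and `k₂`, and the left bounds say
-- that `j₁ ⊔ j₂` is at most `k₃`.
move-balanced : ∀ B {s} → Balanced B s → Balanced (swap B) (move B s)
move-balanced B {s@(internal k₁ k₂ k₃)} b = record
  { cross   = cross′
  ; x-line  = x-line′
  ; x-bound = complementary-≤ (sym x-line′) l₂≤i₃
  ; y-line  = y-line′
  ; y-bound = complementary-≤ (sym y-line′) l₁≤j₃
  }
  where
  open Boundary B
  open Balanced b
  m l₁ l₂ l₃ : ℕ
  m = crossMin s
  l₁ = m + (j₁ ∸ j₂)
  l₂ = m + (j₂ ∸ j₁)
  l₃ = (i₃ + i₂) ∸ l₂

  l₁+j₂ : l₁ + j₂ ≡ m + (j₁ ⊔ j₂)
  l₁+j₂ = shift-⊔ m j₁ j₂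

  cross′ : j₂ + l₁ ≡ j₁ + l₂
  cross′ = shift-balanced m j₁ j₂

  l₂+j₁ : l₂ + j₁ ≡ m + (j₁ ⊔ j₂)
  l₂+j₁ = trans (+-comm l₂ j₁) (trans (sym cross′) (trans (+-comm j₂ l₁) l₁+j₂))

  l₂≤i₃ : l₂ ≤ i₃
  l₂≤i₃ = +-cancelʳ-≤ j₁ l₂ i₃ (begin
    l₂ + j₁         ≡⟨ l₂+j₁ ⟩
    m + (j₁ ⊔ j₂)   ≤⟨ +-mono-≤ (m⊓n≤m k₁ k₂) (⊔-lub y-bound x-bound) ⟩
    k₁ + k₃         ≡⟨ +-comm k₁ k₃ ⟩
    k₃ + k₁         ≡⟨ y-line ⟩
    i₃ + j₁         ∎)
    where open ≤-Reasoning

  l₁≤j₃ : l₁ ≤ j₃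
  l₁≤j₃ = +-cancelʳ-≤ j₂ l₁ j₃ (begin
    l₁ + j₂         ≡⟨ l₁+j₂ ⟩
    m + (j₁ ⊔ j₂)   ≤⟨ +-mono-≤ (m⊓n≤n k₁ k₂) (⊔-lub y-bound x-bound) ⟩
    k₂ + k₃         ≡⟨ +-comm k₂ k₃ ⟩
    k₃ + k₂         ≡⟨ x-line ⟩
    j₃ + j₂         ∎)
    where open ≤-Reasoning

  x-line′ : l₃ + l₂ ≡ i₃ + i₂
  x-line′ = m∸n+n≡m (≤-trans l₂≤i₃ (m≤m+n i₃ i₂))

  -- The second line is not free: it follows from the first one, the cross and the conservation of
  -- the boundary data.
  y-line′ : l₃ + l₁ ≡ j₃ + i₁
  y-line′ = cancel (x-line′ ⊕ cross′ ⊕ sym conserved) (lemma l₁ l₂ l₃ i₁ i₂ i₃ j₁ j₂ j₃)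
    where
    lemma : ∀ l₁ l₂ l₃ i₁ i₂ i₃ j₁ j₂ j₃ →
      l₃ + l₁ + (i₃ + i₂ + (j₁ + l₂) + (i₁ + j₂ + j₃))
      ≡ j₃ + i₁ + (l₃ + l₂ + (j₂ + l₁) + (i₂ + i₃ + j₁))
    lemma = solve-∀

-- swap (swap B) and B differ in the proof of conservation only.
unswap : ∀ B {s} → Balanced (swap (swap B)) s → Balanced B s
unswap B b = record { Balanced b }

-- Moving forth and back keeps `crossMin`, which is a coordinate on balanced states.
move-involutive : ∀ B {s} → Balanced B s → move (swap B) (move B s) ≡ s
move-involutive B {s} b = balanced-unique B (unswap B (move-balanced (swap B) (move-balanced B b))) b
  (trans (crossMin-move (swap B) (move B s)) (crossMin-move B s))

module _ (B : Boundary) where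
  open Boundary B
  open YangBaxter B

  leftWeight-balanced : ∀ {s} → Balanced B s →
                        leftWeight s ≡ just (crossMin s + j₂ , crossMin s + j₁)
  leftWeight-balanced {internal k₁ k₂ k₃} record
    { cross = cross ; x-line = x-line ; x-bound = x-bound ; y-line = y-line ; y-bound = y-bound }
    rewrite R-value i₂ i₁ k₂ k₁ cross | Wx-value k₃ k₂ j₃ j₂ x-line x-bound
          | Wy*-value i₃ k₁ k₃ j₁ y-line y-bound | ⊓-comm k₂ k₁
          | +-identityʳ (k₁ ⊓ k₂ + j₂) | +-identityʳ (k₁ ⊓ k₂) = refl

  -- The exponent of the right cross is fixed by the boundary, so the right weight shows `k₁` and
  -- `k₂` separately, whereas the left weight shows only their minimum.
  rightWeight-balanced : ∀ {t} → Balanced (swap B) t →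
    rightWeight t ≡ just (Internal.k₂ t + j₁ ⊓ j₂ , Internal.k₁ t + j₁ ⊓ j₂)
  rightWeight-balanced {internal k₁ k₂ k₃} record
    { cross = cross ; x-line = x-line ; x-bound = x-bound ; y-line = y-line ; y-bound = y-bound }
    rewrite Wx-value i₃ i₂ k₃ k₂ (sym x-line) (complementary-≤ x-line x-bound)
          | Wy*-value k₃ i₁ j₃ k₁ (sym y-line) (complementary-≤ y-line y-bound)
          | R-value k₂ k₁ j₂ j₁ (trans (+-comm k₂ j₁) (trans (sym cross) (+-comm j₂ k₁)))
          | ⊓-comm j₂ j₁ | +-identityʳ k₂ = refl

  left-balanced : ∀ {s} → Nonzero (leftWeight s) → Balanced B s
  left-balanced {internal k₁ k₂ k₃} nz =
    let nz₁₂ , nz₃ = ⊗-nonzero (R i₂ i₁ k₂ k₁ ⊗ Wx k₃ k₂ j₃ j₂) _ nz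
        nz₁ , nz₂ = ⊗-nonzero (R i₂ i₁ k₂ k₁) _ nz₁₂
        x-line , x-bound = Wx-nonzero k₃ k₂ j₃ j₂ nz₂
        y-line , y-bound = Wy*-nonzero i₃ k₁ k₃ j₁ nz₃
    in record { cross = R-nonzero i₂ i₁ k₂ k₁ nz₁ ; x-line = x-line ; x-bound = x-bound
              ; y-line = y-line ; y-bound = y-bound }

  right-balanced : ∀ {t} → Nonzero (rightWeight t) → Balanced (swap B) t
  right-balanced {internal k₁ k₂ k₃} nz =
    let nz₁₂ , nz₃ = ⊗-nonzero (Wx i₃ i₂ k₃ k₂ ⊗ Wy* k₃ i₁ j₃ k₁) _ nz
        nz₁ , nz₂ = ⊗-nonzero (Wx i₃ i₂ k₃ k₂) _ nz₁₂
        x-line , x-bound = Wx-nonzero i₃ i₂ k₃ k₂ nz₁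
        y-line , y-bound = Wy*-nonzero k₃ i₁ j₃ k₁ nz₂
        cross = R-nonzero k₂ k₁ j₂ j₁ nz₃
    in record
      { cross = trans (+-comm j₂ k₁) (trans (sym cross) (+-comm k₂ j₁))
      ; x-line = sym x-line ; x-bound = complementary-≤ x-line x-bound
      ; y-line = sym y-line ; y-bound = complementary-≤ y-line y-bound }

  leftState : ∀ {s} → Balanced B s → LeftState
  leftState {s} b = s , nonzero-≡ (leftWeight-balanced b)

  rightState : ∀ {t} → Balanced (swap B) t → RightState
  rightState {t} b = t , nonzero-≡ (rightWeight-balanced b)

  Σ-Nonzero-≡ : ∀ {w : Internal → Weight} {s t : Σ Internal (Nonzero ∘ w)} →
                proj₁ s ≡ proj₁ t → s ≡ t
  Σ-Nonzero-≡ {s = s , p} {t = _ , q} refl = cong (s ,_) (Any.irrelevant (λ _ _ → refl) p q)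

  moveState : LeftState → RightState
  moveState (s , nz) = rightState (move-balanced B (left-balanced nz))

  unmoveState : RightState → LeftState
  unmoveState (t , nz) = leftState (unswap B (move-balanced (swap B) (right-balanced nz)))

  moveState-isMove : IsMove moveState
  moveState-isMove = record
    { bijective = inverseᵇ⇒bijective {f⁻¹ = unmoveState}
        ( strictlyInverseˡ⇒inverseˡ {f⁻¹ = unmoveState} moveState
            -- `move` never looks at the proof of conservation, so `move (swap (swap B))` computes
            -- to `move B`.
            (λ (_ , nz) → Σ-Nonzero-≡ {rightWeight} (move-involutive (swap B) (right-balanced nz)))
        , strictlyInverseʳ⇒inverseʳ {f⁻¹ = unmoveState} moveState
            (λ (_ , nz) → Σ-Nonzero-≡ {leftWeight} (move-involutive B (left-balanced nz))))
    ; weight-preserving = λ (s , nz) → preserving s (left-balanced nz) }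
    where
    preserving : ∀ s → Balanced B s → rightWeight (move B s) ≡ leftWeight s
    preserving s b = begin
      rightWeight (move B s)
        ≡⟨ rightWeight-balanced (move-balanced B b) ⟩
      just (m + (j₂ ∸ j₁) + j₁ ⊓ j₂ , m + (j₁ ∸ j₂) + j₁ ⊓ j₂)
        ≡⟨ cong₂ (λ p q → just (p , q)) eq₂ (shift-⊓ m j₁ j₂) ⟩
      just (m + j₂ , m + j₁)
        ≡⟨ leftWeight-balanced b ⟨
      leftWeight s ∎
      where
      open ≡-Reasoning
      m : ℕ
      m = crossMin s
      eq₂ : m + (j₂ ∸ j₁) + j₁ ⊓ j₂ ≡ m + j₂
      eq₂ = trans (cong (m + (j₂ ∸ j₁) +_) (⊓-comm j₁ j₂)) (shift-⊓ m j₂ j₁)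

  -- Comparing the exponents of y suffices. As `φ` is an arbitrary move, the result of a column does
  -- not depend on the one chosen.
  isMove-k₁ : ∀ {φ} → IsMove φ → ∀ s →
    Internal.k₁ (proj₁ (φ s)) + j₂ ≡ crossMin (proj₁ s) + (j₁ ⊔ j₂)
  isMove-k₁ {φ} isMove s = complementary-⊓⊔ j₁ j₂ (cong proj₂ (just-injective (begin
    _                         ≡⟨ rightWeight-balanced (right-balanced (proj₂ (φ s))) ⟨
    rightWeight (proj₁ (φ s)) ≡⟨ IsMove.weight-preserving isMove s ⟩
    leftWeight (proj₁ s)      ≡⟨ leftWeight-balanced (left-balanced (proj₂ s)) ⟩
    _                         ∎)))
    where open ≡-Reasoning

-- The toggle rule

-- Stated for sequences rather than partitions, because the counts on the RSK side obey the rule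
-- before they are known to be weakly decreasing.
record Toggle (k : ℕ) (lam μ ϰ ν : ℕ → ℕ) : Set where
  field
    first : ν 0 ≡ k + (lam 0 ⊔ μ 0)
    rest  : ∀ c → ν (suc c) + ϰ c ≡ (lam (suc c) ⊔ μ (suc c)) + (lam c ⊓ μ c)

open Toggle

_Interlaces_ : (μ lam : ℕ → ℕ) → Set
μ Interlaces lam = ∀ c → μ c ≤ lam c × lam (suc c) ≤ μ c

module _ {k : ℕ} {lam μ ϰ ν : ℕ → ℕ} (ϰ≺lam : ϰ Interlaces lam) (ϰ≺μ : ϰ Interlaces μ)
         (toggle : Toggle k lam μ ϰ ν) where

  -- Interlacing places `ϰ c` between the maximum of the next parts and the minimum of the current
  -- ones. Replacing either of these by `ϰ c` in `rest` and cancelling gives this bound and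
  -- `toggle-≤⊓`.
  toggle-⊔≤ : ∀ c → lam c ⊔ μ c ≤ ν c
  toggle-⊔≤ zero = subst (lam 0 ⊔ μ 0 ≤_) (sym (first toggle)) (m≤n+m _ k)
  toggle-⊔≤ (suc c) = +-cancelʳ-≤ (ϰ c) _ _ (begin
    (lam (suc c) ⊔ μ (suc c)) + ϰ c
      ≤⟨ +-monoʳ-≤ (lam (suc c) ⊔ μ (suc c)) (⊓-glb (proj₁ (ϰ≺lam c)) (proj₁ (ϰ≺μ c))) ⟩
    (lam (suc c) ⊔ μ (suc c)) + (lam c ⊓ μ c)
      ≡⟨ rest toggle c ⟨
    ν (suc c) + ϰ c ∎)
    where open ≤-Reasoning

  toggle-≤⊓ : ∀ c → ν (suc c) ≤ lam c ⊓ μ c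
  toggle-≤⊓ c = +-cancelʳ-≤ (ϰ c) _ _ (begin
    ν (suc c) + ϰ c
      ≡⟨ rest toggle c ⟩
    (lam (suc c) ⊔ μ (suc c)) + (lam c ⊓ μ c)
      ≤⟨ +-monoˡ-≤ (lam c ⊓ μ c) (⊔-lub (proj₂ (ϰ≺lam c)) (proj₂ (ϰ≺μ c))) ⟩
    ϰ c + (lam c ⊓ μ c)
      ≡⟨ +-comm (ϰ c) _ ⟩
    lam c ⊓ μ c + ϰ c ∎)
    where open ≤-Reasoning

  toggle-lam≺ν : lam Interlaces ν
  toggle-lam≺ν c =
    m⊔n≤o⇒m≤o (lam c) (μ c) (toggle-⊔≤ c) , m≤n⊓o⇒m≤n (lam c) (μ c) (toggle-≤⊓ c)

  toggle-μ≺ν : μ Interlaces ν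
  toggle-μ≺ν c =
    m⊔n≤o⇒n≤o (lam c) (μ c) (toggle-⊔≤ c) , m≤n⊓o⇒m≤o (lam c) (μ c) (toggle-≤⊓ c)

-- One column of the procedure

-- Along a line the differences of parts telescope: with `k₃` equal to ϰ_c - ϰ_{c+1}, the left cross
-- occupations must be λ_c - ϰ_c and μ_c - ϰ_c. Their minimum is the source of the minimum in the
-- toggle rule.
occupation : ∀ k i j a {p p′ b} → k + a ≡ i + j → k + p′ ≡ p → j + p′ ≡ b →
             a + p ≡ i + b
occupation k i j a {p′ = p′} h refl refl = cancel h (lemma k i j a p′)
  where
  lemma : ∀ k i j a p′ → a + (k + p′) + (i + j) ≡ i + (j + p′) + (k + a)
  lemma = solve-∀

toggle-step : ∀ a j m M {b p p′ X Y} → a + j ≡ m + M → j + p′ ≡ b → M + p′ ≡ X → m + p ≡ Y →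
              a + b + p ≡ X + Y
toggle-step a j m M {p = p} {p′} h refl refl refl = cancel h (lemma a j m M p p′)
  where
  lemma : ∀ a j m M p p′ → a + (j + p′) + p + (m + M) ≡ M + p′ + (m + p) + (a + j)
  lemma = solve-∀

⊔-shift : ∀ i j {p a b} → i + p ≡ a → j + p ≡ b → (i ⊔ j) + p ≡ a ⊔ b
⊔-shift i j {p} refl refl = +-distribʳ-⊔ p i j

⊓-shift : ∀ i j {p a b} → i + p ≡ a → j + p ≡ b → i ⊓ j + p ≡ a ⊓ b
⊓-shift i j {p} refl refl = +-distribʳ-⊓ p i j

module _ {i₁ i₂ : ℕ} {lam μ ϰ : Partition} {k : ℕ} where
  open Dragging i₁ i₂ lam μ ϰ k hiding (Computed; Output)

  column-toggle : ∀ {c ν-c ν-1+c} → Column c ν-c ν-1+c →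
    ν-1+c + part ϰ c ≡ (part lam (suc c) ⊔ part μ (suc c)) + (part lam c ⊓ part μ c)
  column-toggle {c} {ν-c} {v} col = subst (λ x → x + part ϰ c ≡ _) (sym v≡)
    (toggle-step l₁ j₂ (k₁ ⊓ k₂) (j₁ ⊔ j₂)
      (isMove-k₁ B isMove s) j₂-def (⊔-shift j₁ j₂ j₁-def j₂-def)
      (⊓-shift k₁ k₂ (trans (occupation k₃ i₃ j₁ k₁ L.y-line k₃-def j₁-def) i₃-def)
                     (trans (occupation k₃ j₃ j₂ k₂ L.x-line k₃-def j₂-def) j₃-def)))
    where
    open Column col
    open Internal (proj₁ s)
    module L = Balanced (left-balanced B {proj₁ s} (proj₂ s))
    module R′ = Balanced (right-balanced B {proj₁ (φ s)} (proj₂ (φ s)))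
    l₁ l₃ : ℕ
    l₁ = Internal.k₁ (proj₁ (φ s))
    l₃ = Internal.k₃ (proj₁ (φ s))
    -- On the right y-line, k₃′ + k₁′ = j₃ + i₁ = ν_c - μ_{c+1}. So `k₃′-def` makes k₁′ equal to
    -- ν_{c+1} - μ_{c+1}, which is the `i₁` of the next column.
    v≡ : v ≡ l₁ + part μ (suc c)
    v≡ = cancel (k₃′-def ⊕ sym i₁-def ⊕ sym j₃-def ⊕ sym R′.y-line)
           (lemma l₁ l₃ v ν-c I₁ j₃ (part μ c) (part μ (suc c)))
      where
      lemma : ∀ l₁ l₃ v n i j p q → v + (n + (i + p) + (j + q) + (l₃ + l₁))
                                   ≡ l₁ + q + (l₃ + v + n + p + (j + i))
      lemma = solve-∀

  toggle-column : ∀ {c ν-c ν-1+c} → ϰ ≺ lam → ϰ ≺ μ → part lam c ≤ ν-c → part μ c ≤ ν-c →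
    ν-1+c + part ϰ c ≡ (part lam (suc c) ⊔ part μ (suc c)) + (part lam c ⊓ part μ c) →
    Column c ν-c ν-1+c
  toggle-column {c} {ν-c} {v} ϰ≺lam ϰ≺μ lam≤ν μ≤ν eq = record
    { B = B ; i₁-def = i₁-def ; i₂-def = i₂-def ; i₃-def = i₃-def ; j₃-def = j₃-def
    ; j₁-def = j₁-def ; j₂-def = j₂-def
    ; φ = moveState B ; isMove = moveState-isMove B ; s = leftState B balanced
    ; k₃-def = k₃-def ; k₃′-def = k₃′-def }
    where
    l l′ m m′ p p′ : ℕ
    l = part lam c
    l′ = part lam (suc c)
    m = part μ c
    m′ = part μ (suc c)
    p = part ϰ c
    p′ = part ϰ (suc c)

    i₁-def : ν-c ∸ m + m ≡ ν-c
    i₁-def = m∸n+n≡m μ≤ν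
    i₂-def : ν-c ∸ l + l ≡ ν-c
    i₂-def = m∸n+n≡m lam≤ν
    i₃-def : l ∸ l′ + l′ ≡ l
    i₃-def = m∸n+n≡m (decreasing lam c)
    j₃-def : m ∸ m′ + m′ ≡ m
    j₃-def = m∸n+n≡m (decreasing μ c)
    j₁-def : l′ ∸ p′ + p′ ≡ l′
    j₁-def = m∸n+n≡m (proj₁ (ϰ≺lam (suc c)))
    j₂-def : m′ ∸ p′ + p′ ≡ m′
    j₂-def = m∸n+n≡m (proj₁ (ϰ≺μ (suc c)))
    k₁-def : l ∸ p + p ≡ l
    k₁-def = m∸n+n≡m (proj₁ (ϰ≺lam c))
    k₂-def : m ∸ p + p ≡ m
    k₂-def = m∸n+n≡m (proj₁ (ϰ≺μ c))
    k₃-def : p ∸ p′ + p′ ≡ p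
    k₃-def = m∸n+n≡m (decreasing ϰ c)

    line : ∀ {i j k₁ k₃ a a′ p p′ : ℕ} → i + a′ ≡ a → j + p′ ≡ a′ → k₁ + p ≡ a → k₃ + p′ ≡ p →
           k₃ + k₁ ≡ i + j
    line {i} {j} {k₁} {k₃} {p′ = p′} refl refl h refl = cancel h (lemma i j k₁ k₃ p′)
      where
      lemma : ∀ i j k₁ k₃ p′ → k₃ + k₁ + (i + (j + p′)) ≡ i + j + (k₁ + (k₃ + p′))
      lemma = solve-∀

    crossing : ∀ {x₁ x₂ l m y₁ y₂ p ν} → x₁ + m ≡ ν → x₂ + l ≡ ν → y₁ + p ≡ l → y₂ + p ≡ m →
            x₂ + y₁ ≡ x₁ + y₂
    crossing {x₁} {x₂} {y₁ = y₁} {y₂} {p} refl h refl refl = cancel h (lemma x₁ x₂ y₁ y₂ p)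
      where
      lemma : ∀ x₁ x₂ y₁ y₂ p → x₂ + y₁ + (x₁ + (y₂ + p)) ≡ x₁ + y₂ + (x₂ + (y₁ + p))
      lemma = solve-∀

    conservation : ∀ {i₁ i₂ i₃ j₁ j₂ j₃ l l′ m m′ p′ ν : ℕ} →
      i₁ + m ≡ ν → i₂ + l ≡ ν → i₃ + l′ ≡ l → j₃ + m′ ≡ m → j₁ + p′ ≡ l′ → j₂ + p′ ≡ m′ →
      i₁ + j₂ + j₃ ≡ i₂ + i₃ + j₁
    conservation {i₁} {i₂} {i₃} {j₁} {j₂} {j₃} {p′ = p′} h refl refl refl refl refl =
      cancel h (lemma i₁ i₂ i₃ j₁ j₂ j₃ p′)
      where
      lemma : ∀ i₁ i₂ i₃ j₁ j₂ j₃ p′ → i₁ + j₂ + j₃ + (i₂ + (i₃ + (j₁ + p′)))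
                                     ≡ i₂ + i₃ + j₁ + (i₁ + (j₃ + (j₂ + p′)))
      lemma = solve-∀

    B : Boundary
    B = record
      { i₁ = ν-c ∸ m ; i₂ = ν-c ∸ l ; i₃ = l ∸ l′ ; j₁ = l′ ∸ p′ ; j₂ = m′ ∸ p′ ; j₃ = m ∸ m′
      ; conserved = conservation i₁-def i₂-def i₃-def j₃-def j₁-def j₂-def }

    balanced : Balanced B (internal (l ∸ p) (m ∸ p) (p ∸ p′))
    balanced = record
      { cross = crossing i₁-def i₂-def k₁-def k₂-def
      ; x-line = line j₃-def j₂-def k₂-def k₃-def
      -- The vertex indicators are exactly the horizontal strip conditions μ_{c+1} ≤ ϰ_c and λ_{c+1}
      -- ≤ ϰ_c.
      ; x-bound = ∸-monoˡ-≤ p′ (proj₂ (ϰ≺μ c))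
      ; y-line = line i₃-def j₁-def k₁-def k₃-def
      ; y-bound = ∸-monoˡ-≤ p′ (proj₂ (ϰ≺lam c)) }

    l₁ l₃ : ℕ
    l₁ = Internal.k₁ (move B (internal (l ∸ p) (m ∸ p) (p ∸ p′)))
    l₃ = Internal.k₃ (move B (internal (l ∸ p) (m ∸ p) (p ∸ p′)))

    v≡ : v ≡ l₁ + m′
    v≡ = +-cancelʳ-≡ p v (l₁ + m′) (trans eq (sym
      (toggle-step l₁ (m′ ∸ p′) ((l ∸ p) ⊓ (m ∸ p)) ((l′ ∸ p′) ⊔ (m′ ∸ p′))
        (shift-⊔ ((l ∸ p) ⊓ (m ∸ p)) (l′ ∸ p′) (m′ ∸ p′)) j₂-def
        (⊔-shift (l′ ∸ p′) (m′ ∸ p′) j₁-def j₂-def) (⊓-shift (l ∸ p) (m ∸ p) k₁-def k₂-def))))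

    k₃′-def : l₃ + v ≡ ν-c
    k₃′-def = begin
      l₃ + v                        ≡⟨ cong (l₃ +_) v≡ ⟩
      l₃ + (l₁ + m′)                ≡⟨ +-assoc l₃ l₁ m′ ⟨
      l₃ + l₁ + m′                  ≡⟨ cong (_+ m′) (Balanced.y-line (move-balanced B balanced)) ⟩
      (m ∸ m′) + (ν-c ∸ m) + m′     ≡⟨ cong (_+ m′) (+-comm (m ∸ m′) (ν-c ∸ m)) ⟩
      (ν-c ∸ m) + (m ∸ m′) + m′     ≡⟨ +-assoc (ν-c ∸ m) (m ∸ m′) m′ ⟩
      (ν-c ∸ m) + ((m ∸ m′) + m′)   ≡⟨ cong (ν-c ∸ m +_) j₃-def ⟩
      (ν-c ∸ m) + m                 ≡⟨ i₁-def ⟩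
      ν-c                           ∎
      where open ≡-Reasoning

  -- The incoming occupations fix only the difference of `k₁` and `k₂`, while the weight sees only
  -- their minimum. Hence they have no influence on ν₁.
  column₀-left : ∀ {k₁ k₂ j₁ j₂} → i₂ + k₁ ≡ i₁ + k₂ → k₁ ⊓ k₂ ≡ k →
                 R i₂ i₁ k₂ k₁ ⊗ x^ j₂ ⊗ y^ j₁ ≡ just (k + j₂ , k + j₁)
  column₀-left {k₁} {k₂} {j₁} {j₂} cross refl
    rewrite R-value i₂ i₁ k₂ k₁ cross | ⊓-comm k₂ k₁
          | +-identityʳ (k₁ ⊓ k₂ + j₂) | +-identityʳ (k₁ ⊓ k₂) = refl

  column₀-right : ∀ {k₁ k₂ j₁ j₂} → k₂ + j₁ ≡ k₁ + j₂ →
                  x^ k₂ ⊗ y^ k₁ ⊗ R k₂ k₁ j₂ j₁ ≡ just (k₂ + j₁ ⊓ j₂ , k₁ + j₁ ⊓ j₂)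
  column₀-right {k₁} {k₂} {j₁} {j₂} cross
    rewrite R-value k₂ k₁ j₂ j₁ cross | ⊓-comm j₂ j₁ | +-identityʳ k₂ = refl

  column₀-toggle : ∀ {ν₁} → Column₀ ν₁ → ν₁ ≡ k + (part lam 0 ⊔ part μ 0)
  column₀-toggle {ν₁} col = begin
    ν₁                            ≡⟨ ν₁-def ⟨
    k₁′ + part μ 0                ≡⟨ cong (k₁′ +_) j₂-def ⟨
    k₁′ + (j₂ + part ϰ 0)         ≡⟨ +-assoc k₁′ j₂ _ ⟨
    k₁′ + j₂ + part ϰ 0           ≡⟨ cong (_+ part ϰ 0) (complementary-⊓⊔ j₁ j₂ exponent) ⟩
    k + (j₁ ⊔ j₂) + part ϰ 0      ≡⟨ +-assoc k (j₁ ⊔ j₂) _ ⟩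
    k + ((j₁ ⊔ j₂) + part ϰ 0)    ≡⟨ cong (k +_) (⊔-shift j₁ j₂ j₁-def j₂-def) ⟩
    k + (part lam 0 ⊔ part μ 0)   ∎
    where
    open ≡-Reasoning
    open Column₀ col
    cross : i₂ + k₁ ≡ i₁ + k₂
    cross = R-nonzero i₂ i₁ k₂ k₁
      (proj₁ (⊗-nonzero (R i₂ i₁ k₂ k₁) (x^ j₂)
        (proj₁ (⊗-nonzero (R i₂ i₁ k₂ k₁ ⊗ x^ j₂) (y^ j₁) nonzero))))
    cross′ : k₂′ + j₁ ≡ k₁′ + j₂
    cross′ = R-nonzero k₂′ k₁′ j₂ j₁
      (proj₂ (⊗-nonzero (x^ k₂′ ⊗ y^ k₁′) (R k₂′ k₁′ j₂ j₁) (subst Nonzero (sym matched) nonzero)))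
    exponent : k₁′ + j₁ ⊓ j₂ ≡ k + j₁
    exponent = cong proj₂ (just-injective
      (trans (sym (column₀-right cross′)) (trans matched (column₀-left {k₁} cross min-k))))

  toggle-column₀ : ϰ ≺ lam → ϰ ≺ μ → Column₀ (k + (part lam 0 ⊔ part μ 0))
  toggle-column₀ ϰ≺lam ϰ≺μ = record
    -- Both pairs have minimum `k`; the first has the difference of the incoming occupations, the
    -- second that of the occupations on the far right.
    { k₁ = k + (i₁ ∸ i₂) ; k₂ = k + (i₂ ∸ i₁) ; k₁′ = k + (j₁ ∸ j₂) ; k₂′ = k + (j₂ ∸ j₁)
    ; j₁ = j₁ ; j₂ = j₂ ; min-k = shift-min k i₁ i₂
    ; j₁-def = j₁-def
    ; j₂-def = j₂-def
    ; nonzero = nonzero-≡ left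
    ; matched = trans (column₀-right {k + (j₁ ∸ j₂)} cross′)
        (trans (cong₂ (λ p q → just (p , q)) exponent₂ (shift-⊓ k j₁ j₂)) (sym left))
    ; ν₁-def = begin
        k + (j₁ ∸ j₂) + part μ 0             ≡⟨ cong (k + (j₁ ∸ j₂) +_) j₂-def ⟨
        k + (j₁ ∸ j₂) + (j₂ + part ϰ 0)      ≡⟨ +-assoc (k + (j₁ ∸ j₂)) j₂ _ ⟨
        k + (j₁ ∸ j₂) + j₂ + part ϰ 0        ≡⟨ cong (_+ part ϰ 0) (shift-⊔ k j₁ j₂) ⟩
        k + (j₁ ⊔ j₂) + part ϰ 0             ≡⟨ +-assoc k (j₁ ⊔ j₂) _ ⟩
        k + ((j₁ ⊔ j₂) + part ϰ 0)           ≡⟨ cong (k +_) (⊔-shift j₁ j₂ j₁-def j₂-def) ⟩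
        k + (part lam 0 ⊔ part μ 0)          ∎ }
    where
    open ≡-Reasoning
    j₁ j₂ : ℕ
    j₁ = part lam 0 ∸ part ϰ 0
    j₂ = part μ 0 ∸ part ϰ 0
    j₁-def : j₁ + part ϰ 0 ≡ part lam 0
    j₁-def = m∸n+n≡m (proj₁ (ϰ≺lam 0))
    j₂-def : j₂ + part ϰ 0 ≡ part μ 0
    j₂-def = m∸n+n≡m (proj₁ (ϰ≺μ 0))
    left : R i₂ i₁ (k + (i₂ ∸ i₁)) (k + (i₁ ∸ i₂)) ⊗ x^ j₂ ⊗ y^ j₁ ≡ just (k + j₂ , k + j₁)
    left = column₀-left {k + (i₁ ∸ i₂)} (shift-balanced k i₁ i₂) (shift-min k i₁ i₂)
    cross′ : k + (j₂ ∸ j₁) + j₁ ≡ k + (j₁ ∸ j₂) + j₂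
    cross′ = trans (+-comm _ j₁) (trans (shift-balanced k j₂ j₁) (+-comm j₂ _))
    exponent₂ : k + (j₂ ∸ j₁) + j₁ ⊓ j₂ ≡ k + j₂
    exponent₂ = trans (cong (k + (j₂ ∸ j₁) +_) (⊓-comm j₁ j₂)) (shift-⊓ k j₂ j₁)

  toggle-output : ∀ {ν} → ϰ ≺ lam → ϰ ≺ μ → Toggle k (part lam) (part μ) (part ϰ) ν →
                  Output i₁ i₂ lam μ ϰ k ν
  toggle-output ϰ≺lam ϰ≺μ toggle zero =
    subst (Computed i₁ i₂ lam μ ϰ k 0) (sym (first toggle)) (start (toggle-column₀ ϰ≺lam ϰ≺μ))
  toggle-output ϰ≺lam ϰ≺μ toggle (suc c) = next (toggle-output ϰ≺lam ϰ≺μ toggle c)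
    (toggle-column ϰ≺lam ϰ≺μ (proj₁ (toggle-lam≺ν ϰ≺lam ϰ≺μ toggle c))
      (proj₁ (toggle-μ≺ν ϰ≺lam ϰ≺μ toggle c)) (rest toggle c))

  -- There is no induction over the columns: the toggle rule expresses ν_{c+1} by `lam`, `μ` and `ϰ`
  -- alone, so ν_c has dropped out.
  computed-unique : ∀ {ν c v} → Toggle k (part lam) (part μ) (part ϰ) ν →
                    Computed i₁ i₂ lam μ ϰ k c v → ν c ≡ v
  computed-unique toggle (start col) = trans (first toggle) (sym (column₀-toggle col))
  computed-unique {c = suc c} toggle (next _ col) =
    +-cancelʳ-≡ (part ϰ c) _ _ (trans (rest toggle c) (sym (column-toggle col)))

  output-toggle : ∀ {ν} → Output i₁ i₂ lam μ ϰ k ν → Toggle k (part lam) (part μ) (part ϰ) ν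
  output-toggle out = record { first = first′ (out 0) ; rest = λ c → rest′ (out (suc c)) }
    where
    first′ : ∀ {v} → Computed i₁ i₂ lam μ ϰ k 0 v → v ≡ k + (part lam 0 ⊔ part μ 0)
    first′ (start col) = column₀-toggle col
    rest′ : ∀ {c v} → Computed i₁ i₂ lam μ ϰ k (suc c) v →
           v + part ϰ c ≡ (part lam (suc c) ⊔ part μ (suc c)) + (part lam c ⊓ part μ c)
    rest′ (next _ col) = column-toggle col

toggle : ℕ → (lam μ ϰ : ℕ → ℕ) → ℕ → ℕ
toggle k lam μ ϰ zero    = k + (lam 0 ⊔ μ 0)
toggle k lam μ ϰ (suc c) = (lam (suc c) ⊔ μ (suc c)) + (lam c ⊓ μ c) ∸ ϰ c

toggle-toggles : ∀ k {lam μ ϰ} → ϰ Interlaces lam → ϰ Interlaces μ →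
                 Toggle k lam μ ϰ (toggle k lam μ ϰ)
toggle-toggles k {lam} {μ} ϰ≺lam ϰ≺μ = record { first = refl ; rest = λ c →
  m∸n+n≡m (≤-trans (⊓-glb (proj₁ (ϰ≺lam c)) (proj₁ (ϰ≺μ c))) (m≤n+m _ (lam (suc c) ⊔ μ (suc c)))) }

output-unique : ∀ {lam μ ϰ k i₁ i₂} → ϰ ≺ lam → ϰ ≺ μ →
                ∀ c → ∃! _≡_ (Computed i₁ i₂ lam μ ϰ k c)
output-unique {k = k} ϰ≺lam ϰ≺μ c =
  _ , toggle-output ϰ≺lam ϰ≺μ (toggle-toggles k ϰ≺lam ϰ≺μ) c
    , computed-unique (toggle-toggles k ϰ≺lam ϰ≺μ)

-- Row insertion of a weakly increasing word

Word Tableau State : ℕ → Set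
Word N    = List (Fin N)
Tableau N = List (Word N)
State N   = Tableau N × Filling N

combine-⊔ : ∀ {A M B C a m b c} → A ≡ a → M ≡ m → B ≡ b → C ≡ c →
            a ≡ m + (b ⊔ c) → A ≡ M + (B ⊔ C)
combine-⊔ refl refl refl refl eq = eq

combine-⊓ : ∀ {M P B C m p b c} → M ≡ m → P ≡ p → B ≡ b → C ≡ c →
            m + p ≡ b ⊓ c → M + P ≡ B ⊓ C
combine-⊓ refl refl refl refl eq = eq

module _ {N : ℕ} where

  Sorted : Word N → Set
  Sorted = AllPairs Fin._≤_

  Above : ℕ → Word N → Set
  Above n = All (λ e → n ≤ toℕ e)

  above-trans : ∀ {m n row} → m ≤ n → Above n row → Above m row
  above-trans m≤n = All.map (≤-trans m≤n)

  -- Inserted w row row′ out: inserting the word w into row gives row′ and bumps out the word out.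
  data Inserted : (w row row′ out : Word N) → Set where
    done   : ∀ {row} → Inserted [] row row []
    append : ∀ {w} → Inserted w [] w []
    bump   : ∀ {x e w row row′ out} → x Fin.< e →
             Inserted w row row′ out → Inserted (x ∷ w) (e ∷ row) (x ∷ row′) (e ∷ out)
    pass   : ∀ {x e w row row′ out} → e Fin.≤ x →
             Inserted (x ∷ w) row row′ out → Inserted (x ∷ w) (e ∷ row) (e ∷ row′) out

  ∃-inserted : ∀ w row → ∃₂ (Inserted w row)
  ∃-inserted []      row = _ , _ , done
  ∃-inserted (x ∷ w) []  = _ , _ , append
  ∃-inserted (x ∷ w) (e ∷ row) with x Fin.<? e
  ... | yes x<e = let _ , _ , ins = ∃-inserted w row in _ , _ , bump x<e ins
  ... | no  x≮e = let _ , _ , ins = ∃-inserted (x ∷ w) row in _ , _ , pass (≮⇒≥ x≮e) ins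

  pass-word : ∀ {e w row row′ out} → Above (toℕ e) w →
              Inserted w row row′ out → Inserted w (e ∷ row) (e ∷ row′) out
  pass-word []        done   = done
  pass-word []        append = done
  pass-word (e≤x ∷ _) ins    = pass e≤x ins

  inserted-row-All : ∀ {P : Fin N → Set} {w row row′ out} → Inserted w row row′ out →
                     All P w → All P row → All P row′
  inserted-row-All done         pw        prow        = prow
  inserted-row-All append       pw        prow        = pw
  inserted-row-All (bump _ ins) (px ∷ pw) (_ ∷ prow)  = px ∷ inserted-row-All ins pw prow
  inserted-row-All (pass _ ins) pw        (pe ∷ prow) = pe ∷ inserted-row-All ins pw prow

  inserted-above : ∀ {e x : Fin N} {w row row′ out} → Inserted (x ∷ w) row row′ out → e Fin.≤ x →
                   Sorted (x ∷ w) → Above (toℕ e) row → Above (toℕ e) row′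
  inserted-above ins e≤x (x≤w ∷ _) e≤row =
    inserted-row-All ins (e≤x ∷ above-trans e≤x x≤w) e≤row

  inserted-out-All : ∀ {P : Fin N → Set} {w row row′ out} → Inserted w row row′ out →
                     All P row → All P out
  inserted-out-All done         prow        = []
  inserted-out-All append       prow        = []
  inserted-out-All (bump _ ins) (pe ∷ prow) = pe ∷ inserted-out-All ins prow
  inserted-out-All (pass _ ins) (pe ∷ prow) = inserted-out-All ins prow

  inserted-Sorted : ∀ {w row row′ out} → Inserted w row row′ out →
                    Sorted w → Sorted row → Sorted row′ × Sorted out
  inserted-Sorted done   sw srow = srow , []
  inserted-Sorted append sw srow = sw , []
  inserted-Sorted (bump x<e ins) (x≤w ∷ sw) (e≤row ∷ srow) =
    let srow′ , sout = inserted-Sorted ins sw srow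
        x≤row = above-trans (<⇒≤ x<e) e≤row
    in inserted-row-All ins x≤w x≤row ∷ srow′ , inserted-out-All ins e≤row ∷ sout
  inserted-Sorted (pass e≤x ins) sw (e≤row ∷ srow) =
    let srow′ , sout = inserted-Sorted ins sw srow
    in inserted-above ins e≤x sw e≤row ∷ srow′ , sout

  -- Entries are indexed from 0, so below n row counts the letters 1, …, n of the paper.
  below : ℕ → Word N → ℕ
  below n row = length (filter (λ e → toℕ e <? n) row)

  multiplicity : ℕ → Word N → ℕ
  multiplicity n w = length (filter (λ e → toℕ e ≟ n) w)

  below-∷-< : ∀ {n e row} → toℕ e < n → below n (e ∷ row) ≡ suc (below n row)
  below-∷-< {n} e<n = cong length (filter-accept (λ e → toℕ e <? n) e<n)

  below-∷-≥ : ∀ {n e row} → n ≤ toℕ e → below n (e ∷ row) ≡ below n row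
  below-∷-≥ {n} n≤e = cong length (filter-reject (λ e → toℕ e <? n) (≤⇒≯ n≤e))

  below-none : ∀ {n row} → Above n row → below n row ≡ 0
  below-none n≤row = cong length (filter-none (λ e → toℕ e <? _) (All.map ≤⇒≯ n≤row))

  multiplicity-∷-≡ : ∀ {n e w} → toℕ e ≡ n → multiplicity n (e ∷ w) ≡ suc (multiplicity n w)
  multiplicity-∷-≡ {n} e≡n = cong length (filter-accept (λ e → toℕ e ≟ n) e≡n)

  multiplicity-∷-≢ : ∀ {n e w} → toℕ e ≢ n → multiplicity n (e ∷ w) ≡ multiplicity n w
  multiplicity-∷-≢ {n} e≢n = cong length (filter-reject (λ e → toℕ e ≟ n) e≢n)

  below-suc : ∀ n row → below (suc n) row ≡ multiplicity n row + below n row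
  below-suc n [] = refl
  below-suc n (e ∷ row) with <-cmp (toℕ e) n
  ... | tri< e<n e≢n _ = begin
    below (suc n) (e ∷ row)                       ≡⟨ below-∷-< (m<n⇒m<1+n e<n) ⟩
    suc (below (suc n) row)                       ≡⟨ cong suc (below-suc n row) ⟩
    suc (multiplicity n row + below n row)        ≡⟨ +-suc _ _ ⟨
    multiplicity n row + suc (below n row)
      ≡⟨ cong₂ _+_ (multiplicity-∷-≢ e≢n) (below-∷-< e<n) ⟨
    multiplicity n (e ∷ row) + below n (e ∷ row)  ∎
    where open ≡-Reasoning
  ... | tri≈ _ e≡n _ = begin
    below (suc n) (e ∷ row)                       ≡⟨ below-∷-< (s≤s (≤-reflexive e≡n)) ⟩
    suc (below (suc n) row)                       ≡⟨ cong suc (below-suc n row) ⟩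
    suc (multiplicity n row) + below n row
      ≡⟨ cong₂ _+_ (multiplicity-∷-≡ e≡n) (below-∷-≥ (≤-reflexive (sym e≡n))) ⟨
    multiplicity n (e ∷ row) + below n (e ∷ row)  ∎
    where open ≡-Reasoning
  ... | tri> _ e≢n n<e = begin
    below (suc n) (e ∷ row)                       ≡⟨ below-∷-≥ n<e ⟩
    below (suc n) row                             ≡⟨ below-suc n row ⟩
    multiplicity n row + below n row
      ≡⟨ cong₂ _+_ (multiplicity-∷-≢ e≢n) (below-∷-≥ (<⇒≤ n<e)) ⟨
    multiplicity n (e ∷ row) + below n (e ∷ row)  ∎
    where open ≡-Reasoning

  below-mono : ∀ n row → below n row ≤ below (suc n) row
  below-mono n row = subst (below n row ≤_) (sym (below-suc n row)) (m≤n+m _ _)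

  -- Induction along the sweep: each case compares `n` with the letter now at the head of the new
  -- row, and `combine-⊔` gathers the effect of the heads on the four counts.
  inserted-below : ∀ {w row row′ out} → Inserted w row row′ out → Sorted w → Sorted row → ∀ n →
    below (suc n) row′ ≡ multiplicity n w + (below n row′ ⊔ below (suc n) row)
  inserted-below {row = row} done _ _ n = sym (m≤n⇒m⊔n≡n (below-mono n row))
  inserted-below {w} append _ _ n =
    trans (below-suc n w) (cong (multiplicity n w +_) (sym (⊔-identityʳ _)))
  inserted-below (bump {x} {e} {w} {row} {row′} x<e ins) (_ ∷ sw) (e≤row ∷ srow) n
    with inserted-below ins sw srow n | <-cmp n (toℕ x)
  ... | IH | tri< n<x n≢x _ =
    combine-⊔ (below-∷-≥ n<x) (multiplicity-∷-≢ (n≢x ∘ sym)) (below-∷-≥ (<⇒≤ n<x))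
      (below-∷-≥ (<-trans n<x x<e)) IH
  ... | IH | tri≈ _ refl _ =
    combine-⊔ (below-∷-< {row = row′} (n<1+n n)) (multiplicity-∷-≡ {w = w} refl)
      (below-∷-≥ {row = row′} ≤-refl)
      (below-∷-≥ x<e) (cong suc IH)
  ... | IH | tri> _ n≢x x<n with toℕ e ≤? n
  ...   | yes e≤n =
    combine-⊔ (below-∷-< (m<n⇒m<1+n x<n)) (multiplicity-∷-≢ (n≢x ∘ sym)) (below-∷-< x<n)
      (below-∷-< (s≤s e≤n)) (trans (cong suc IH) (sym (+-suc _ _)))
  -- Here x < n < e, so the old row has no entry at most `n` and the maximum is the first of its
  -- arguments.
  ...   | no  e≰n =
    combine-⊔ (below-∷-< (m<n⇒m<1+n x<n)) (multiplicity-∷-≢ (n≢x ∘ sym)) (below-∷-< x<n)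
      (trans (below-∷-≥ (≰⇒> e≰n)) none)
      (trans (cong suc (trans IH (cong (multiplicity n w +_)
               (trans (cong (below n row′ ⊔_) none) (⊔-identityʳ _)))))
             (sym (+-suc _ _)))
    where
    none : below (suc n) row ≡ 0
    none = below-none (above-trans (≰⇒> e≰n) e≤row)
  inserted-below (pass {x} {e} {w} {row} {row′} e≤x ins) sw (e≤row ∷ srow) n
    with inserted-below ins sw srow n | <-cmp n (toℕ e)
  ... | IH | tri< n<e _ _ =
    combine-⊔ (below-∷-≥ n<e) (refl {x = multiplicity n (x ∷ w)})
      (below-∷-≥ (<⇒≤ n<e)) (below-∷-≥ n<e) IH
  -- All of `row′` lies at or above `e`, so here the maximum is the second of its arguments.
  ... | IH | tri≈ _ refl _ =
    combine-⊔ (below-∷-< {row = row′} (n<1+n n)) (refl {x = multiplicity n (x ∷ w)})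
      (trans (below-∷-≥ {row = row′} ≤-refl) none)
      (below-∷-< {row = row} (n<1+n n))
      (trans (cong suc (trans IH
        (cong (λ b → multiplicity n (x ∷ w) + (b ⊔ below (suc n) row)) none)))
             (sym (+-suc _ _)))
    where
    none : below n row′ ≡ 0
    none = below-none (inserted-above ins e≤x sw e≤row)
  ... | IH | tri> _ _ e<n =
    combine-⊔ (below-∷-< (m<n⇒m<1+n e<n)) (refl {x = multiplicity n (x ∷ w)})
      (below-∷-< e<n) (below-∷-< (m<n⇒m<1+n e<n))
      (trans (cong suc IH) (sym (+-suc _ _)))

  inserted-out : ∀ {w row row′ out} → Inserted w row row′ out → Sorted w → Sorted row → ∀ n →
    multiplicity n out + below n row ≡ below n row′ ⊓ below (suc n) row
  inserted-out {row = row} done _ _ n = sym (m≤n⇒m⊓n≡m (below-mono n row))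
  inserted-out {w} append _ _ n = sym (⊓-zeroʳ (below n w))
  inserted-out (bump {x} {e} {w} {row} {row′} {out} x<e ins) (_ ∷ sw) (e≤row ∷ srow) n
    with inserted-out ins sw srow n | <-cmp n (toℕ e)
  ... | IH | tri< n<e n≢e _ =
    combine-⊓ (multiplicity-∷-≢ (n≢e ∘ sym)) (below-∷-≥ (<⇒≤ n<e)) refl
      (trans (below-∷-≥ n<e) none)
      (trans IH (trans (cong (below n row′ ⊓_) none)
        (trans (⊓-zeroʳ (below n row′)) (sym (⊓-zeroʳ (below n (x ∷ row′)))))))
    where
    none : below (suc n) row ≡ 0
    none = below-none (above-trans n<e e≤row)
  ... | IH | tri≈ _ refl _ =
    combine-⊓ (multiplicity-∷-≡ {w = out} refl) (below-∷-≥ {row = row} ≤-refl)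
      (below-∷-< x<e) (below-∷-< {row = row} (n<1+n n)) (cong suc IH)
  ... | IH | tri> _ n≢e e<n =
    combine-⊓ (multiplicity-∷-≢ (n≢e ∘ sym)) (below-∷-< e<n) (below-∷-< (<-trans x<e e<n))
      (below-∷-< (m<n⇒m<1+n e<n)) (trans (+-suc _ _) (cong suc IH))
  inserted-out (pass {x} {e} {w} {row} {row′} {out} e≤x ins) sw (e≤row ∷ srow) n
    with inserted-out ins sw srow n | <-cmp n (toℕ e)
  ... | IH | tri< n<e _ _ =
    combine-⊓ (refl {x = multiplicity n out})
      (below-∷-≥ (<⇒≤ n<e)) (below-∷-≥ (<⇒≤ n<e)) (below-∷-≥ n<e) IH
  ... | IH | tri≈ _ refl _ =
    combine-⊓ (refl {x = multiplicity n out})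
      (below-∷-≥ {row = row} ≤-refl) (trans (below-∷-≥ {row = row′} ≤-refl) none) refl
      (trans IH (cong (_⊓ below (suc n) row) none))
    where
    none : below n row′ ≡ 0
    none = below-none (inserted-above ins e≤x sw e≤row)
  ... | IH | tri> _ _ e<n =
    combine-⊓ (refl {x = multiplicity n out})
      (below-∷-< e<n) (below-∷-< e<n) (below-∷-< (m<n⇒m<1+n e<n))
      (trans (+-suc _ _) (cong suc IH))

-- Insertion of a weakly increasing word into a tableau

module _ {N : ℕ} where

  -- The letters of `w` are at least `x`, so they pass every box up to and including the one where
  -- `x` lands. The sweep of `x ∷ w` thus splits into Schensted insertion of `x` and a sweep of `w`.
  rowInsert-inserted : ∀ {x : Fin N} {w row row′ out} → Inserted (x ∷ w) row row′ out →
    Above (toℕ x) w →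
    ∃ λ out′ → Inserted w (proj₁ (rowInsert x row)) row′ out′
             × out ≡ fromMaybe (proj₂ (rowInsert x row)) ++ out′
  rowInsert-inserted append x≤w = [] , pass-word x≤w append , refl
  rowInsert-inserted {x} {row = e ∷ row} (bump x<e ins) x≤w with x Fin.<? e
  ... | yes _  = _ , pass-word x≤w ins , refl
  ... | no x≮e = contradiction x<e x≮e
  rowInsert-inserted {x} {w} {row = e ∷ row} (pass e≤x ins) x≤w with x Fin.<? e
  ... | yes x<e = contradiction x<e (≤⇒≯ e≤x)
  ... | no _    = let out′ , ins′ , eq = rowInsert-inserted ins x≤w
                  in out′ , pass-word (above-trans e≤x x≤w) ins′ , eq

  insertWord : Word N → Tableau N → Tableau N
  insertWord w P = foldl (λ P a → proj₁ (insert a P)) P w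

  -- Treating the replaced entry as a word of length at most one unites the two outcomes of a row
  -- insertion.
  insert-∷ : ∀ x row rows → proj₁ (insert x (row ∷ rows)) ≡
    proj₁ (rowInsert x row) ∷ insertWord (fromMaybe (proj₂ (rowInsert x row))) rows
  insert-∷ x row rows with rowInsert x row
  ... | _ , nothing = refl
  ... | _ , just _  = refl

  -- The lower rows see only the bumped letters, in the order in which they are bumped. Their
  -- insertion can therefore wait until all of `w` has passed the first row.
  insertWord-∷ : ∀ {w row row′ out} rows → Sorted w → Inserted w row row′ out →
                 insertWord w (row ∷ rows) ≡ row′ ∷ insertWord out rows
  insertWord-∷ rows []         done   = refl
  insertWord-∷ rows []         append = refl
  insertWord-∷ {x ∷ w} {row} {row′} {out} rows (x≤w ∷ sw) ins =
    let bumped = fromMaybe (proj₂ (rowInsert x row))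
        out′ , ins′ , eq = rowInsert-inserted ins x≤w
    in begin
    insertWord w (proj₁ (insert x (row ∷ rows)))
      ≡⟨ cong (insertWord w) (insert-∷ x row rows) ⟩
    insertWord w (proj₁ (rowInsert x row) ∷ insertWord bumped rows)
      ≡⟨ insertWord-∷ _ sw ins′ ⟩
    row′ ∷ insertWord out′ (insertWord bumped rows)
      ≡⟨ cong (row′ ∷_) (foldl-++ _ rows bumped out′) ⟨
    row′ ∷ insertWord (bumped ++ out′) rows
      ≡⟨ cong (λ o → row′ ∷ insertWord o rows) eq ⟨
    row′ ∷ insertWord out rows ∎
    where open ≡-Reasoning

  rowAt : ℕ → Tableau N → Word N
  rowAt r       []         = []
  rowAt zero    (row ∷ P)  = row
  rowAt (suc r) (row ∷ P)  = rowAt r P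

  rowAt-drop : ∀ r P → rowAt r (drop 1 P) ≡ rowAt (suc r) P
  rowAt-drop r []      = refl
  rowAt-drop r (_ ∷ _) = refl

  -- Phrased through `rowAt`, where missing rows are empty, so that it also covers the empty
  -- tableau, to which the empty word adds no row.
  insertWord-rowAt : ∀ {w row′ out} P → Sorted w → Inserted w (rowAt 0 P) row′ out →
    rowAt 0 (insertWord w P) ≡ row′
    × (∀ r → rowAt (suc r) (insertWord w P) ≡ rowAt r (insertWord out (drop 1 P)))
  insertWord-rowAt (row ∷ rows) sw ins =
    cong (rowAt 0) (insertWord-∷ rows sw ins) , λ r → cong (rowAt (suc r)) (insertWord-∷ rows sw ins)
  insertWord-rowAt [] _ done = refl , λ _ → refl
  insertWord-rowAt {[]} [] _ append = refl , λ _ → refl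
  insertWord-rowAt {x ∷ w} [] (x≤w ∷ sw) append =
    let eq = insertWord-∷ [] sw (pass-word x≤w append)
    in cong (rowAt 0) eq , λ r → cong (rowAt (suc r)) eq

  SortedRows : Tableau N → Set
  SortedRows P = ∀ r → Sorted (rowAt r P)

  drop-SortedRows : ∀ {P} → SortedRows P → SortedRows (drop 1 P)
  drop-SortedRows {P} sP r = subst Sorted (sym (rowAt-drop r P)) (sP (suc r))

  insertWord-SortedRows : ∀ {w} P → Sorted w → SortedRows P → SortedRows (insertWord w P)
  insertWord-SortedRows {w} P sw sP r with ∃-inserted w (rowAt 0 P)
  ... | row′ , out , ins = go r
    where
    srow′ : Sorted row′
    srow′ = proj₁ (inserted-Sorted ins sw (sP 0))
    sout : Sorted out
    sout = proj₂ (inserted-Sorted ins sw (sP 0))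
    go : ∀ r → Sorted (rowAt r (insertWord w P))
    go zero    = subst Sorted (sym (proj₁ (insertWord-rowAt P sw ins))) srow′
    go (suc r) = subst Sorted (sym (proj₂ (insertWord-rowAt P sw ins) r))
      (insertWord-SortedRows (drop 1 P) sout (drop-SortedRows {P} sP) r)

  shape : ℕ → Tableau N → ℕ → ℕ
  shape n P r = below n (rowAt r P)

  -- For two neighbouring rows, `inserted-below` for the lower one and `inserted-out` for the upper
  -- one share the multiplicity of `n` in the bumped word; `exchange` eliminates it.
  insertWord-toggle : ∀ {w} P → Sorted w → SortedRows P → ∀ n →
    Toggle (multiplicity n w) (shape n (insertWord w P)) (shape (suc n) P) (shape n P)
           (shape (suc n) (insertWord w P))
  insertWord-toggle {w} P sw sP n = record { first = first′ P sw sP ; rest = rest′ P sw sP }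
    where
    exchange : ∀ {y m a p q} → y ≡ m + a → m + p ≡ q → y + p ≡ a + q
    exchange {m = m} {a} {p} refl refl = trans (cong (_+ p) (+-comm m a)) (+-assoc a m p)

    first′ : ∀ {w} P → Sorted w → SortedRows P →
      shape (suc n) (insertWord w P) 0
      ≡ multiplicity n w + (shape n (insertWord w P) 0 ⊔ shape (suc n) P 0)
    first′ {w} P sw sP with ∃-inserted w (rowAt 0 P)
    ... | row′ , out , ins rewrite proj₁ (insertWord-rowAt P sw ins) =
      inserted-below ins sw (sP 0) n

    rest′ : ∀ {w} P → Sorted w → SortedRows P → ∀ r →
      shape (suc n) (insertWord w P) (suc r) + shape n P r
      ≡ (shape n (insertWord w P) (suc r) ⊔ shape (suc n) P (suc r))
        + (shape n (insertWord w P) r ⊓ shape (suc n) P r)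
    rest′ {w} P sw sP zero with ∃-inserted w (rowAt 0 P)
    ... | row′ , out , ins
      rewrite proj₁ (insertWord-rowAt P sw ins) | proj₂ (insertWord-rowAt P sw ins) 0
            | sym (rowAt-drop 0 P)
            = exchange (first′ (drop 1 P) (proj₂ (inserted-Sorted ins sw (sP 0)))
                                      (drop-SortedRows {P} sP))
                (inserted-out ins sw (sP 0) n)
    rest′ {w} P sw sP (suc r) with ∃-inserted w (rowAt 0 P)
    ... | row′ , out , ins
      rewrite proj₂ (insertWord-rowAt P sw ins) r | proj₂ (insertWord-rowAt P sw ins) (suc r)
            | sym (rowAt-drop r P) | sym (rowAt-drop (suc r) P) =
      rest′ (drop 1 P) (proj₂ (inserted-Sorted ins sw (sP 0))) (drop-SortedRows {P} sP) r

-- The boxes added to the shape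

module _ {N : ℕ} where

  rowInsert-length : ∀ (a : Fin N) row → length (proj₁ (rowInsert a row)) ≡
                     maybe (λ _ → 0) 1 (proj₂ (rowInsert a row)) + length row
  rowInsert-length a [] = refl
  rowInsert-length a (e ∷ row) with a Fin.<? e
  ... | yes _ = refl
  ... | no  _ = trans (cong suc (rowInsert-length a row))
                      (sym (+-suc (maybe (λ _ → 0) 1 (proj₂ (rowInsert a row))) (length row)))

  rowLength : ℕ → Tableau N → ℕ
  rowLength r P = length (rowAt r P)

  record AddsBox (P P′ : Tableau N) (new : Box) : Set where
    field
      before    : rowLength (proj₁ new) P ≡ proj₂ new
      after     : rowLength (proj₁ new) P′ ≡ suc (proj₂ new)
      elsewhere : ∀ r → r ≢ proj₁ new → rowLength r P′ ≡ rowLength r P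

  insert-addsBox : ∀ a P → AddsBox P (proj₁ (insert a P)) (proj₂ (insert a P))
  insert-addsBox a [] = record { before = refl ; after = refl ; elsewhere = elsewhere }
    where
    elsewhere : ∀ r → r ≢ 0 → rowLength r ((a ∷ []) ∷ []) ≡ 0
    elsewhere zero    r≢0 = contradiction refl r≢0
    elsewhere (suc r) _   = refl
  insert-addsBox a (row ∷ rows) with rowInsert a row | rowInsert-length a row
  ... | row′ , nothing | eq = record { before = refl ; after = eq ; elsewhere = elsewhere }
    where
    elsewhere : ∀ r → r ≢ 0 → rowLength r (row′ ∷ rows) ≡ rowLength r (row ∷ rows)
    elsewhere zero    r≢0 = contradiction refl r≢0
    elsewhere (suc r) _   = refl
  ... | row′ , just e | eq = record { before = before ; after = after ; elsewhere = elsewhere′ }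
    where
    open AddsBox (insert-addsBox e rows)
    elsewhere′ : ∀ r → r ≢ suc (proj₁ (proj₂ (insert e rows))) →
                 rowLength r (row′ ∷ proj₁ (insert e rows)) ≡ rowLength r (row ∷ rows)
    elsewhere′ zero    _  = eq
    elsewhere′ (suc r) r≢ = elsewhere r (r≢ ∘ cong suc)

  -- Row lengths before and after split the boxes into old, new and outside ones; in this form
  -- consecutive insertions with the same upper letter compose.
  record Recorded (b : Fin N) (P : Tableau N) (Q : Filling N)
                  (P′ : Tableau N) (Q′ : Filling N) : Set where
    field
      grows   : ∀ r → rowLength r P ≤ rowLength r P′
      old     : ∀ {r c} → c < rowLength r P → Q′ (r , c) ≡ Q (r , c)
      new     : ∀ {r c} → rowLength r P ≤ c → c < rowLength r P′ → Q′ (r , c) ≡ just b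
      outside : ∀ {r c} → rowLength r P′ ≤ c → Q′ (r , c) ≡ Q (r , c)

  record-in-new : ∀ new b (Q : Filling N) {box} → box ≡ new → record-in new b Q box ≡ just b
  record-in-new new b Q {box} eq with ≡-dec _≟_ _≟_ box new
  ... | yes _  = refl
  ... | no neq = contradiction eq neq

  record-in-old : ∀ new b (Q : Filling N) {box} → box ≢ new → record-in new b Q box ≡ Q box
  record-in-old new b Q {box} neq with ≡-dec _≟_ _≟_ box new
  ... | yes eq = contradiction eq neq
  ... | no _   = refl

  record-in-recorded : ∀ {P P′ new} b Q → AddsBox P P′ new → Recorded b P Q P′ (record-in new b Q)
  record-in-recorded {P} {P′} {box@(r₀ , c₀)} b Q adds = record
    { grows   = grows
    ; old     = λ c<len → record-in-old box b Q
        λ { refl → <-irrefl (sym before) c<len }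
    ; new     = new
    ; outside = λ len≤c → record-in-old box b Q
        λ { refl → <-irrefl refl (≤-trans (≤-reflexive (sym after)) len≤c) }
    }
    where
    open AddsBox adds
    grows : ∀ r → rowLength r P ≤ rowLength r P′
    grows r with r ≟ r₀
    ... | yes refl = ≤-trans (≤-reflexive before) (≤-trans (n≤1+n c₀) (≤-reflexive (sym after)))
    ... | no r≢r₀  = ≤-reflexive (sym (elsewhere r r≢r₀))
    new : ∀ {r c} → rowLength r P ≤ c → c < rowLength r P′ → record-in box b Q (r , c) ≡ just b
    new {r} {c} len≤c c<len′ = record-in-new box b Q (is-new (r ≟ r₀))
      where
      is-new : Dec (r ≡ r₀) → (r , c) ≡ box
      is-new (yes refl) = cong (r₀ ,_) (≤-antisym
        (s≤s⁻¹ (≤-trans c<len′ (≤-reflexive after))) (≤-trans (≤-reflexive (sym before)) len≤c))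
      is-new (no r≢r₀)  = contradiction
        (≤-trans c<len′ (≤-trans (≤-reflexive (elsewhere r r≢r₀)) len≤c)) (<-irrefl refl)

  recorded-trans : ∀ {b P Q P′ Q′ P″ Q″} → Recorded b P Q P′ Q′ → Recorded b P′ Q′ P″ Q″ →
                   Recorded b P Q P″ Q″
  recorded-trans {b} {P} {Q} {P′} {Q′} {P″} {Q″} rec rec′ = record
    { grows   = λ r → ≤-trans (R₁.grows r) (R₂.grows r)
    ; old     = λ {r} c<len → trans (R₂.old (≤-trans c<len (R₁.grows r))) (R₁.old c<len)
    ; new     = new
    ; outside = λ {r} len≤c → trans (R₂.outside len≤c) (R₁.outside (≤-trans (R₂.grows r) len≤c))
    }
    where
    module R₁ = Recorded rec
    module R₂ = Recorded rec′
    new : ∀ {r c} → rowLength r P ≤ c → c < rowLength r P″ → Q″ (r , c) ≡ just b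
    new {r} {c} len≤c c<len″ with c <? rowLength r P′
    ... | yes c<len′ = trans (R₂.old c<len′) (R₁.new len≤c c<len′)
    ... | no  c≮len′ = R₂.new (≮⇒≥ c≮len′) c<len″

  -- A named counterpart of the step local to `rsk`, to which `rsk-states` passes.
  rskStep : State N → Fin N × Fin N → State N
  rskStep (P , Q) (b , a) = proj₁ (insert a P) , record-in (proj₂ (insert a P)) b Q

  rskStep-word : ∀ b w P Q → let P′ , Q′ = foldl rskStep (P , Q) (map (b ,_) w) in
                 P′ ≡ insertWord w P × Recorded b P Q P′ Q′
  rskStep-word b [] P Q = refl , record
    { grows = λ _ → ≤-refl ; old = λ _ → refl ; outside = λ _ → refl
    ; new = λ len≤c c<len → contradiction (≤-trans c<len len≤c) (<-irrefl refl) }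
  rskStep-word b (a ∷ w) P Q =
    let eq , rec = rskStep-word b w (proj₁ (insert a P)) (record-in (proj₂ (insert a P)) b Q)
    in eq , recorded-trans (record-in-recorded b Q (insert-addsBox a P)) rec

-- Cutting the biword into the columns of the matrix

scan : ∀ {A : Set} {n} → (Fin n → A → A) → A → Fin (suc n) → A
scan             g z zero    = z
scan {n = suc n} g z (suc i) = scan (g ∘ suc) (g zero z) i

-- `scan` peels off the first step of the fold, while induction over the columns needs the last one.
scan-suc : ∀ {A : Set} {n} (g : Fin n → A → A) z i →
           scan g z (suc i) ≡ g i (scan g z (inject₁ i))
scan-suc g z zero    = refl
scan-suc g z (suc i) = scan-suc (g ∘ suc) (g zero z) i

scan-fromℕ : ∀ {A B : Set} {n} (h : B → A → A) (f : Fin n → B) z →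
             foldl (λ z x → h x z) z (tabulate f) ≡ scan (h ∘ f) z (fromℕ n)
scan-fromℕ {n = zero}  h f z = refl
scan-fromℕ {n = suc n} h f z = scan-fromℕ h (f ∘ suc) (h (f zero) z)

foldl-concatMap : ∀ {A B C : Set} (f : C → B → C) (g : A → List B) z xs →
                  foldl f z (concatMap g xs) ≡ foldl (λ z x → foldl f z (g x)) z xs
foldl-concatMap f g z []       = refl
foldl-concatMap f g z (x ∷ xs) =
  trans (foldl-++ f z (g x) (concatMap g xs)) (foldl-concatMap f g (foldl f z (g x)) xs)

module _ {N : ℕ} where

  multiplicity-++ : ∀ n (v w : Word N) → multiplicity n (v ++ w) ≡ multiplicity n v + multiplicity n w
  multiplicity-++ n v w = trans (cong length (filter-++ (λ e → toℕ e ≟ n) v w))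
    (length-++ (filter (λ e → toℕ e ≟ n) v))

  multiplicity-replicate-≡ : ∀ m (a : Fin N) → multiplicity (toℕ a) (replicate m a) ≡ m
  multiplicity-replicate-≡ m a = trans
    (cong length (filter-all (λ e → toℕ e ≟ toℕ a) (Allₚ.replicate⁺ m refl))) (length-replicate m)

  multiplicity-replicate-≢ : ∀ m {a b : Fin N} → b ≢ a → multiplicity (toℕ a) (replicate m b) ≡ 0
  multiplicity-replicate-≢ m {a} b≢a =
    cong length (filter-none (λ e → toℕ e ≟ toℕ a) (Allₚ.replicate⁺ m (b≢a ∘ Finₚ.toℕ-injective)))

  -- `allFin N` is `tabulate id`, but its tail is `tabulate suc`; a general `h` here and in
  -- `multiplicity-tabulate` makes the induction possible.
  multiplicity-absent : ∀ {n} (h : Fin n → Fin N) (k : Fin N → ℕ) {a} → (∀ i → h i ≢ a) →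
    multiplicity (toℕ a) (concatMap (λ x → replicate (k x) x) (tabulate h)) ≡ 0
  multiplicity-absent {zero}  h k h≢a = refl
  multiplicity-absent {suc n} h k {a} h≢a = trans
    (multiplicity-++ (toℕ a) (replicate (k (h zero)) (h zero)) _)
    (cong₂ _+_ (multiplicity-replicate-≢ (k (h zero)) (h≢a zero))
               (multiplicity-absent (h ∘ suc) k (h≢a ∘ suc)))

  multiplicity-tabulate : ∀ {n} (h : Fin n → Fin N) (k : Fin N → ℕ) → Injective _≡_ _≡_ h → ∀ i →
    multiplicity (toℕ (h i)) (concatMap (λ x → replicate (k x) x) (tabulate h)) ≡ k (h i)
  multiplicity-tabulate {suc n} h k inj zero = trans
    (multiplicity-++ (toℕ (h zero)) (replicate (k (h zero)) (h zero)) _)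
    (trans (cong₂ _+_ (multiplicity-replicate-≡ (k (h zero)) (h zero))
                      (multiplicity-absent (h ∘ suc) k (λ i eq → Finₚ.0≢1+n (sym (inj eq)))))
           (+-identityʳ _))
  multiplicity-tabulate {suc n} h k inj (suc i) = trans
    (multiplicity-++ (toℕ (h (suc i))) (replicate (k (h zero)) (h zero)) _)
    (cong₂ _+_ (multiplicity-replicate-≢ (k (h zero)) (λ eq → Finₚ.0≢1+n (inj eq)))
               (multiplicity-tabulate (h ∘ suc) k (Finₚ.suc-injective ∘ inj) i))

  column : Matrix N → Fin N → Word N
  column k b = concatMap (λ a → replicate (k a b) a) (allFin N)

  column-multiplicity : ∀ k a b → multiplicity (toℕ a) (column k b) ≡ k a b
  column-multiplicity k a b = multiplicity-tabulate id (λ a → k a b) id a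

  replicate-Sorted : ∀ n (a : Fin N) → Sorted (replicate n a)
  replicate-Sorted zero    a = []
  replicate-Sorted (suc n) a = Allₚ.replicate⁺ n ≤-refl ∷ replicate-Sorted n a

  column-Sorted : ∀ k b → Sorted (column k b)
  column-Sorted k b = AllPairsₚ.concat⁺
    (Allₚ.map⁺ (Allₚ.tabulate⁺ (λ a → replicate-Sorted (k a b) a)))
    (AllPairsₚ.map⁺ (AllPairsₚ.tabulate⁺-< (λ {i} {j} i<j →
      Allₚ.replicate⁺ (k i b) (Allₚ.replicate⁺ (k j b) (<⇒≤ i<j)))))

  biword-column : ∀ (k : Matrix N) b →
    concatMap (λ a → replicate (k a b) (b , a)) (allFin N) ≡ map (b ,_) (column k b)
  biword-column k b = trans
    (concatMap-cong (λ a → sym (map-replicate (b ,_) (k a b) a)) (allFin N))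
    (sym (map-concatMap (b ,_) (λ a → replicate (k a b) a) (allFin N)))

  addColumn : Matrix N → Fin N → State N → State N
  addColumn k b S = foldl rskStep S (map (b ,_) (column k b))

  -- states k b is the pair (P, Q) after the part of the biword with upper letters of index < b.
  states : Matrix N → Fin (suc N) → State N
  states k = scan (addColumn k) ([] , λ _ → nothing)

  rsk-states : ∀ k → rsk k ≡ states k (fromℕ N)
  rsk-states k = begin
    rsk k
      ≡⟨ foldl-cong (λ _ _ → refl) _ (biword k) ⟩
    foldl rskStep ([] , λ _ → nothing) (biword k)
      ≡⟨ foldl-concatMap rskStep _ _ (allFin N) ⟩
    foldl (λ S b → foldl rskStep S (concatMap (λ a → replicate (k a b) (b , a)) (allFin N))) _ (allFin N)
      ≡⟨ foldl-cong (λ S b → cong (foldl rskStep S) (biword-column k b)) _ (allFin N) ⟩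
    foldl (λ S b → addColumn k b S) ([] , λ _ → nothing) (allFin N)
      ≡⟨ scan-fromℕ (addColumn k) id _ ⟩
    states k (fromℕ N) ∎
    where open ≡-Reasoning

-- Families of shapes governed by the toggle rule

toggle-cong : ∀ {k lam μ ϰ ν lam′ μ′ ϰ′ ν′} → Toggle k lam μ ϰ ν → Toggle k lam′ μ′ ϰ′ ν′ →
              lam ≗ lam′ → μ ≗ μ′ → ϰ ≗ ϰ′ → ν ≗ ν′
toggle-cong {k} t t′ lam≗ μ≗ ϰ≗ zero = trans (Toggle.first t)
  (trans (cong (k +_) (cong₂ _⊔_ (lam≗ 0) (μ≗ 0))) (sym (Toggle.first t′)))
toggle-cong {ν = ν} {ϰ′ = ϰ′} {ν′} t t′ lam≗ μ≗ ϰ≗ (suc c) = +-cancelʳ-≡ (ϰ′ c) _ _ (begin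
  ν (suc c) + ϰ′ c
    ≡⟨ cong (ν (suc c) +_) (ϰ≗ c) ⟨
  ν (suc c) + _
    ≡⟨ Toggle.rest t c ⟩
  _
    ≡⟨ cong₂ _+_ (cong₂ _⊔_ (lam≗ (suc c)) (μ≗ (suc c))) (cong₂ _⊓_ (lam≗ c) (μ≗ c)) ⟩
  _
    ≡⟨ Toggle.rest t′ c ⟨
  ν′ (suc c) + ϰ′ c ∎)
  where open ≡-Reasoning

record IsToggleFamily {N} (k : Matrix N) (F : Fin (suc N) → Fin (suc N) → ℕ → ℕ) : Set where
  field
    emptyˡ : ∀ b c → F zero b c ≡ 0
    emptyʳ : ∀ a c → F a zero c ≡ 0
    cell   : ∀ a b → Toggle (k a b) (F (inject₁ a) (suc b)) (F (suc a) (inject₁ b))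
                            (F (inject₁ a) (inject₁ b)) (F (suc a) (suc b))

-- Induction over the rows and, within a row, over the columns: the borders are empty and each cell
-- is computed from its three predecessors.
family-unique : ∀ {N} {k : Matrix N} {F G} → IsToggleFamily k F → IsToggleFamily k G →
                ∀ a b → F a b ≗ G a b
family-unique {F = F} {G} isF isG = <-weakInduction (λ a → ∀ b → F a b ≗ G a b)
  (λ b c → trans (F.emptyˡ b c) (sym (G.emptyˡ b c)))
  λ a IHa → <-weakInduction (λ b → F (suc a) b ≗ G (suc a) b)
    (λ c → trans (F.emptyʳ (suc a) c) (sym (G.emptyʳ (suc a) c)))
    λ b IHb → toggle-cong (F.cell a b) (G.cell a b) (IHa (suc b)) IHb (IHa (inject₁ b))
  where
  module F = IsToggleFamily isF
  module G = IsToggleFamily isG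

module _ {N} {k : Matrix N} {F} (isF : IsToggleFamily k F) where
  open IsToggleFamily isF

  zero-interlaces : ∀ {f g : ℕ → ℕ} → (∀ c → f c ≡ 0) → (∀ c → g c ≡ 0) → f Interlaces g
  zero-interlaces f≡0 g≡0 c =
    ≤-reflexive (trans (f≡0 c) (sym (g≡0 c))) , ≤-reflexive (trans (g≡0 (suc c)) (sym (f≡0 c)))

  -- A cell needs both interlacings of its `ϰ` before it yields new ones. The one with `lam` comes
  -- from the finished row, the one with `μ` from the preceding cell.
  vertical-from-horizontal : ∀ a →
    (∀ b → F (inject₁ a) (inject₁ b) Interlaces F (inject₁ a) (suc b)) →
                             ∀ b → F (inject₁ a) b Interlaces F (suc a) b
  vertical-from-horizontal a hor = <-weakInduction (λ b → F (inject₁ a) b Interlaces F (suc a) b)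
    (zero-interlaces (emptyʳ (inject₁ a)) (emptyʳ (suc a)))
    λ b ver → toggle-lam≺ν (hor b) ver (cell a b)

  horizontal : ∀ a b → F a (inject₁ b) Interlaces F a (suc b)
  horizontal = <-weakInduction (λ a → ∀ b → F a (inject₁ b) Interlaces F a (suc b))
    (λ b → zero-interlaces (emptyˡ (inject₁ b)) (emptyˡ (suc b)))
    λ a hor b → toggle-μ≺ν (hor b) (vertical-from-horizontal a hor (inject₁ b)) (cell a b)

  vertical : ∀ a b → F (inject₁ a) b Interlaces F (suc a) b
  vertical a = vertical-from-horizontal a (horizontal (inject₁ a))

  -- Two consecutive parts are separated by a part of the preceding shape. Applied to RSK, this
  -- makes the shapes partitions without a study of the columns of the tableau.
  family-decreasing : ∀ a b c → F a b (suc c) ≤ F a b c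
  family-decreasing zero    b c = ≤-trans (≤-reflexive (emptyˡ b (suc c))) z≤n
  family-decreasing (suc a) b c = ≤-trans (proj₂ (vertical a b c)) (proj₁ (vertical a b c))

grid-family : ∀ {N} {i₁ i₂ k : Matrix N} {Λ} → IsGrid i₁ i₂ k Λ →
              IsToggleFamily k (λ a b → part (Λ a b))
grid-family isGrid = record
  { emptyˡ = emptyˡ ; emptyʳ = emptyʳ ; cell = λ a b → output-toggle (cell a b) }
  where open IsGrid isGrid

-- The shapes of the insertion tableaux

module _ {N : ℕ} where

  below-0 : ∀ (row : Word N) → below 0 row ≡ 0
  below-0 row = below-none (All.universal (λ _ → z≤n) row)

  below-N : ∀ (row : Word N) → below N row ≡ length row
  below-N row = cong length (filter-all (λ e → toℕ e <? N) (All.universal Finₚ.toℕ<n row))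

  below-∷-≤ : ∀ n (e : Fin N) row → below n (e ∷ row) ≤ suc (below n row)
  below-∷-≤ n e row = by-cases (toℕ e <? n)
    where
    by-cases : Dec (toℕ e < n) → below n (e ∷ row) ≤ suc (below n row)
    by-cases (yes e<n) = ≤-reflexive (below-∷-< {row = row} e<n)
    by-cases (no e≮n)  = ≤-trans (≤-reflexive (below-∷-≥ {row = row} (≮⇒≥ e≮n))) (n≤1+n _)

  rowAt-beyond : ∀ r (P : Tableau N) → length P ≤ r → rowAt r P ≡ []
  rowAt-beyond r       []      _         = refl
  rowAt-beyond (suc r) (_ ∷ P) (s≤s len≤r) = rowAt-beyond r P len≤r

  filling-rowAt : ∀ (P : Tableau N) r c → filling P (r , c) ≡ rowEntry (rowAt r P) c
  filling-rowAt []      r       c = refl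
  filling-rowAt (_ ∷ _) zero    c = refl
  filling-rowAt (_ ∷ P) (suc r) c = filling-rowAt P r c

  -- In a sorted row equal entries form one block, and `below` gives its two ends.
  rowEntry⇒below : ∀ {row : Word N} → Sorted row → ∀ c {a} → rowEntry row c ≡ just a →
                   below (toℕ a) row ≤ c × c < below (suc (toℕ a)) row
  rowEntry⇒below {e ∷ row} (e≤row ∷ srow) zero refl =
    ≤-reflexive (below-none (≤-refl ∷ e≤row)) ,
    ≤-trans (s≤s z≤n) (≤-reflexive (sym (below-∷-< {row = row} (n<1+n (toℕ e)))))
  rowEntry⇒below {e ∷ row} (e≤row ∷ srow) (suc c) {a} eq with rowEntry⇒below srow c eq
  ... | lower , upper = ≤-trans (below-∷-≤ (toℕ a) e row) (s≤s lower) , upper′ (toℕ e ≤? toℕ a)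
    where
    upper′ : Dec (toℕ e ≤ toℕ a) → suc c < below (suc (toℕ a)) (e ∷ row)
    upper′ (yes e≤a) = ≤-trans (s≤s upper) (≤-reflexive (sym (below-∷-< {row = row} (s≤s e≤a))))
    upper′ (no e≰a)  = contradiction
      (≤-trans upper (≤-reflexive (below-none (above-trans (≰⇒> e≰a) e≤row)))) λ ()

  below⇒rowEntry : ∀ {row : Word N} → Sorted row → ∀ c {a} → below (toℕ a) row ≤ c →
                   c < below (suc (toℕ a)) row → rowEntry row c ≡ just a
  below⇒rowEntry {e ∷ row} (e≤row ∷ srow) zero {a} lower upper =
    cong just (Finₚ.toℕ-injective (≤-antisym (≮⇒≥ a≮e) (≮⇒≥ e≮a)))
    where
    a≮e : toℕ a ≮ toℕ e
    a≮e a<e = contradiction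
      (≤-trans upper (≤-reflexive (below-none (a<e ∷ above-trans a<e e≤row)))) λ ()
    e≮a : toℕ e ≮ toℕ a
    e≮a e<a = contradiction (≤-trans (≤-reflexive (sym (below-∷-< {row = row} e<a))) lower) λ ()
  below⇒rowEntry {e ∷ row} (e≤row ∷ srow) (suc c) {a} lower upper =
    below⇒rowEntry srow c (lower′ (toℕ e <? toℕ a))
      (s≤s⁻¹ (≤-trans upper (below-∷-≤ (suc (toℕ a)) e row)))
    where
    lower′ : Dec (toℕ e < toℕ a) → below (toℕ a) row ≤ c
    lower′ (yes e<a) = s≤s⁻¹ (≤-trans (≤-reflexive (sym (below-∷-< {row = row} e<a))) lower)
    lower′ (no e≮a)  = ≤-trans (≤-reflexive (below-none (above-trans (≮⇒≥ e≮a) e≤row))) z≤n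

module _ {N} (k : Matrix N) where

  tableau : Fin (suc N) → Tableau N
  tableau b = proj₁ (states k b)

  recording : Fin (suc N) → Filling N
  recording b = proj₂ (states k b)

  tableau-suc : ∀ b → tableau (suc b) ≡ insertWord (column k b) (tableau (inject₁ b))
  tableau-suc b = trans (cong proj₁ (scan-suc (addColumn k) _ b))
    (proj₁ (rskStep-word b (column k b) (tableau (inject₁ b)) (recording (inject₁ b))))

  recorded-suc : ∀ b → Recorded b (tableau (inject₁ b)) (recording (inject₁ b))
                                  (tableau (suc b)) (recording (suc b))
  recorded-suc b = subst
    (λ S → Recorded b (tableau (inject₁ b)) (recording (inject₁ b)) (proj₁ S) (proj₂ S))
    (sym (scan-suc (addColumn k) _ b))
    (proj₂ (rskStep-word b (column k b) (tableau (inject₁ b)) (recording (inject₁ b))))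

  tableau-SortedRows : ∀ b → SortedRows (tableau b)
  tableau-SortedRows = <-weakInduction (SortedRows ∘ tableau) (λ _ → [])
    λ b sorted → subst SortedRows (sym (tableau-suc b))
      (insertWord-SortedRows (tableau (inject₁ b)) (column-Sorted k b) sorted)

  rskShape : Fin (suc N) → Fin (suc N) → ℕ → ℕ
  rskShape a b = shape (toℕ a) (tableau b)

  rskShape-family : IsToggleFamily k rskShape
  rskShape-family = record
    { emptyˡ = λ b r → below-0 (rowAt r (tableau b))
    ; emptyʳ = λ _ _ → refl
    ; cell   = cell
    }
    where
    cell : ∀ a b → Toggle (k a b) (rskShape (inject₁ a) (suc b)) (rskShape (suc a) (inject₁ b))
                          (rskShape (inject₁ a) (inject₁ b)) (rskShape (suc a) (suc b))
    -- The shapes at `inject₁ a` and `suc a` count entries less than and at most `a`, and k_{ab}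
    -- becomes the multiplicity of `a` in the inserted word.
    cell a b rewrite Finₚ.toℕ-inject₁ a | tableau-suc b | sym (column-multiplicity k a b) =
      insertWord-toggle (tableau (inject₁ b)) (column-Sorted k b)
        (tableau-SortedRows (inject₁ b)) (toℕ a)

  shapePartition : Fin (suc N) → Fin (suc N) → Partition
  shapePartition a b = record
    { part = rskShape a b
    ; decreasing = family-decreasing rskShape-family a b
    ; finite = length (tableau b) , λ r len≤r → cong (below (toℕ a)) (rowAt-beyond r (tableau b) len≤r) }

  -- A grid exists because RSK supplies one: its shapes obey the toggle rule and interlace, so a run
  -- of the procedure in each cell reaches them.
  shapePartition-grid : ∀ i₁ i₂ → IsGrid i₁ i₂ k shapePartition
  shapePartition-grid i₁ i₂ = record
    { emptyˡ = emptyˡ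
    ; emptyʳ = emptyʳ
    ; ϰ≺lam  = λ a b → horizontal rskShape-family (inject₁ a) b
    ; ϰ≺μ    = λ a b → vertical rskShape-family a (inject₁ b)
    ; cell   = λ a b → toggle-output
        {lam = shapePartition (inject₁ a) (suc b)} {shapePartition (suc a) (inject₁ b)}
        {shapePartition (inject₁ a) (inject₁ b)}
        (horizontal rskShape-family (inject₁ a) b) (vertical rskShape-family a (inject₁ b)) (cell a b)
    }
    where open IsToggleFamily rskShape-family

  insertionTableau-shape : ∀ a r c → insertionTableau k (r , c) ≡ just a ⇔
    (rskShape (inject₁ a) (fromℕ N) r ≤ c × c < rskShape (suc a) (fromℕ N) r)
  insertionTableau-shape a r c
    rewrite rsk-states k | Finₚ.toℕ-inject₁ a | filling-rowAt (tableau (fromℕ N)) r c =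
    mk⇔ (rowEntry⇒below sorted c) (λ (lower , upper) → below⇒rowEntry sorted c lower upper)
    where
    sorted : Sorted (rowAt r (tableau (fromℕ N)))
    sorted = tableau-SortedRows (fromℕ N) r

  -- The recording tableau

  tableau-grows : ∀ b d r → toℕ d < toℕ b → rowLength r (tableau (suc d)) ≤ rowLength r (tableau b)
  tableau-grows = <-weakInduction _ (λ _ _ ()) λ b grows d r d<1+b →
    step b grows d r (m≤n⇒m<n∨m≡n (s≤s⁻¹ d<1+b))
    where
    step : ∀ b → (∀ d r → toℕ d < toℕ (inject₁ b) →
                    rowLength r (tableau (suc d)) ≤ rowLength r (tableau (inject₁ b))) →
           ∀ d r → toℕ d < toℕ b ⊎ toℕ d ≡ toℕ b →
           rowLength r (tableau (suc d)) ≤ rowLength r (tableau (suc b))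
    step b grows d r (inj₁ d<b) = ≤-trans
      (grows d r (≤-trans d<b (≤-reflexive (sym (Finₚ.toℕ-inject₁ b)))))
      (Recorded.grows (recorded-suc b) r)
    step b grows d r (inj₂ d≡b) rewrite Finₚ.toℕ-injective d≡b = ≤-refl

  AddedBy : Fin N → ℕ → ℕ → Set
  AddedBy d r c = rowLength r (tableau (inject₁ d)) ≤ c × c < rowLength r (tableau (suc d))

  -- The condition that `d` precedes `b` carries the induction: boxes that only later columns will
  -- add are still blank. At `fromℕ N` it always holds.
  recording⇔ : ∀ b d r c → recording b (r , c) ≡ just d ⇔ (toℕ d < toℕ b × AddedBy d r c)
  recording⇔ = <-weakInduction _ (λ d r c → mk⇔ (λ ()) (λ ())) step
    where
    step : ∀ b → (∀ d r c → recording (inject₁ b) (r , c) ≡ just d ⇔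
                              (toℕ d < toℕ (inject₁ b) × AddedBy d r c)) →
           ∀ d r c → recording (suc b) (r , c) ≡ just d ⇔ (toℕ d < suc (toℕ b) × AddedBy d r c)
    step b IH d r c =
      by-cases (c <? rowLength r (tableau (inject₁ b))) (c <? rowLength r (tableau (suc b)))
      where
      open Recorded (recorded-suc b)
      d<b : toℕ d < toℕ b → toℕ d < toℕ (inject₁ b)
      d<b lt = ≤-trans lt (≤-reflexive (sym (Finₚ.toℕ-inject₁ b)))

      unchanged : recording (suc b) (r , c) ≡ recording (inject₁ b) (r , c) → ¬ AddedBy b r c →
                  recording (suc b) (r , c) ≡ just d ⇔ (toℕ d < suc (toℕ b) × AddedBy d r c)
      unchanged same ¬added = mk⇔ to from
        where
        to : recording (suc b) (r , c) ≡ just d → toℕ d < suc (toℕ b) × AddedBy d r c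
        to eq with Equivalence.to (IH d r c) (trans (sym same) eq)
        ... | lt , added = m<n⇒m<1+n (≤-trans lt (≤-reflexive (Finₚ.toℕ-inject₁ b))) , added
        from : toℕ d < suc (toℕ b) × AddedBy d r c → recording (suc b) (r , c) ≡ just d
        from (d<1+b , added) with m≤n⇒m<n∨m≡n (s≤s⁻¹ d<1+b)
        ... | inj₁ lt  = trans same (Equivalence.from (IH d r c) (d<b lt , added))
        ... | inj₂ d≡b = contradiction
          (subst (λ d → AddedBy d r c) (Finₚ.toℕ-injective d≡b) added) ¬added

      changed : AddedBy b r c →
                recording (suc b) (r , c) ≡ just d ⇔ (toℕ d < suc (toℕ b) × AddedBy d r c)
      changed added@(len≤c , c<len′) = mk⇔ to from
        where
        to : recording (suc b) (r , c) ≡ just d → toℕ d < suc (toℕ b) × AddedBy d r c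
        to eq with just-injective (trans (sym (new len≤c c<len′)) eq)
        ... | refl = n<1+n (toℕ b) , added
        from : toℕ d < suc (toℕ b) × AddedBy d r c → recording (suc b) (r , c) ≡ just d
        from (d<1+b , _ , c<len) with m≤n⇒m<n∨m≡n (s≤s⁻¹ d<1+b)
        -- A box added by an earlier column already lies in the tableau before column `b`, so column
        -- `b` cannot add it.
        ... | inj₁ lt  = contradiction
          (≤-trans c<len (≤-trans (tableau-grows (inject₁ b) d r (d<b lt)) len≤c)) (<-irrefl refl)
        ... | inj₂ d≡b = trans (new len≤c c<len′) (cong just (sym (Finₚ.toℕ-injective d≡b)))

      by-cases : Dec (c < rowLength r (tableau (inject₁ b))) →
                 Dec (c < rowLength r (tableau (suc b))) →
                 recording (suc b) (r , c) ≡ just d ⇔ (toℕ d < suc (toℕ b) × AddedBy d r c)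
      by-cases (yes c<len) _ =
        unchanged (old c<len) λ (len≤c , _) → <-irrefl refl (≤-trans c<len len≤c)
      by-cases (no c≮len) (yes c<len′) = changed (≮⇒≥ c≮len , c<len′)
      by-cases (no _)     (no c≮len′)  =
        unchanged (outside (≮⇒≥ c≮len′)) λ (_ , c<len′) → c≮len′ c<len′

  rskShape-rowLength : ∀ b r → rskShape (fromℕ N) b r ≡ rowLength r (tableau b)
  rskShape-rowLength b r rewrite Finₚ.toℕ-fromℕ N = below-N (rowAt r (tableau b))

  recordingTableau-shape : ∀ b r c → recordingTableau k (r , c) ≡ just b ⇔
    (rskShape (fromℕ N) (inject₁ b) r ≤ c × c < rskShape (fromℕ N) (suc b) r)
  recordingTableau-shape b r c
    rewrite rsk-states k | rskShape-rowLength (inject₁ b) r | rskShape-rowLength (suc b) r =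
    mk⇔ (proj₂ ∘ Equivalence.to (recording⇔ (fromℕ N) b r c))
        (λ added → Equivalence.from (recording⇔ (fromℕ N) b r c)
          (≤-trans (Finₚ.toℕ<n b) (≤-reflexive (sym (Finₚ.toℕ-fromℕ N))) , added))

filledBy-cong : ∀ {N} (Λ : Fin (suc N) → Partition) {f : Fin (suc N) → ℕ → ℕ} {T : Filling N} →
  (∀ a → f a ≗ part (Λ a)) →
  (∀ a r c → T (r , c) ≡ just a ⇔ (f (inject₁ a) r ≤ c × c < f (suc a) r)) → FilledBy Λ T
filledBy-cong Λ f≗Λ filled (r , c) a = mk⇔
  (λ eq → let lower , upper = Equivalence.to (filled a r c) eq
          in subst (_≤ c) (f≗Λ (inject₁ a) r) lower , subst (c <_) (f≗Λ (suc a) r) upper)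
  (λ (lower , upper) → Equivalence.from (filled a r c)
    (subst (_≤ c) (sym (f≗Λ (inject₁ a) r)) lower , subst (c <_) (sym (f≗Λ (suc a) r)) upper))

proposition3p5 :
    ((lam μ ϰ : Partition) (k : ℕ) → ϰ ≺ lam → ϰ ≺ μ → (i₁ i₂ : ℕ) →
        (∀ c → ∃! _≡_ (Computed i₁ i₂ lam μ ϰ k c))
      × (∀ ν → Output i₁ i₂ lam μ ϰ k ν →
            ν 0 ≡ k + (part lam 0 ⊔ part μ 0)
          × (∀ c → ν (suc c) + part ϰ c
                     ≡ (part lam (suc c) ⊔ part μ (suc c)) + (part lam c ⊓ part μ c))))
    × ((N : ℕ) (k i₁ i₂ : Matrix N) →
        ∃! (λ Λ Λ′ → ∀ a b → Λ a b ≈ Λ′ a b) (IsGrid i₁ i₂ k)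
      × (∀ Λ → IsGrid i₁ i₂ k Λ →
            FilledBy (λ a → Λ a (fromℕ N)) (insertionTableau k)
          × FilledBy (λ b → Λ (fromℕ N) b) (recordingTableau k)))
proposition3p5 =
    (λ lam μ ϰ k ϰ≺lam ϰ≺μ i₁ i₂ →
        output-unique ϰ≺lam ϰ≺μ
      , λ ν out → Toggle.first (output-toggle out) , Toggle.rest (output-toggle out))
  , λ N k i₁ i₂ →
      -- Agreement with the RSK shapes gives both the uniqueness of the grid and the transfer of the
      -- two tableau descriptions to an arbitrary grid.
      let rskShape≗ : ∀ {Λ} → IsGrid i₁ i₂ k Λ → ∀ a b → rskShape k a b ≗ part (Λ a b)
          rskShape≗ isGrid = family-unique (rskShape-family k) (grid-family isGrid)
      in (shapePartition k , shapePartition-grid k i₁ i₂ , rskShape≗)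
       , λ Λ isGrid →
             filledBy-cong (λ a → Λ a (fromℕ N)) (λ a → rskShape≗ isGrid a (fromℕ N))
               (insertionTableau-shape k)
           , filledBy-cong (Λ (fromℕ N)) (rskShape≗ isGrid (fromℕ N)) (recordingTableau-shape k)
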